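{- Let $p>3$ be a prime. Then \begin{align*} \pounds_2(1\pm i)&\equiv -\frac{q_p(2)^2}{8}\left(1\pm i\left(\frac{ -1}{p}\right)\right)+\frac{1}{2}\left(\frac{ -1}{p}\right)E_{p-3} \pmod{p},\\ \pounds_2\bigl((1\pm i)/2\bigr)&\equiv -\frac{q_p(2)^2}{8}+\frac{1}{4}\left(\left(\frac{ -1}{p}\right)\pm i\right)E_{p-3} \pmod{p}. \end{align*}
   Context: For a prime $p$ and a positive integer $d$, the finite polylogarithm is $\pounds_d(x)=\sum_{k=1}^{p-1} x^k/k^d$. $q_p(a)=(a^{p-1}-1)/p$ is the Fermat quotient. $E_n$ denotes the $n$-th Euler number and $\left(\frac{\cdot}{p}\right)$ the Legendre symbol. Congruences modulo $p$ are taken in the ring of elements of $\mathbb{Q}(i)$ that are integral at all primes above $p$: $a\equiv b\pmod p$ means $(a-b)/p$ is such an element. -}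

module Defs where

open import Data.Nat as ℕ using (ℕ; zero; suc)
open import Data.Nat.Combinatorics using (_C_)
open import Data.Nat.Divisibility using (_∣_)
open import Data.Integer as ℤ using (ℤ; +_)
open import Data.Rational as ℚ using (ℚ)
import Data.Nat.Divisibility as ℕDiv
open import Data.List using (List; []; _∷_; _++_; length; zip; upTo; map; foldr; lookup)
open import Data.Bool.ListAction using (any)
open import Data.Bool using (Bool; true; false; if_then_else_)
open import Data.Fin using (fromℕ<)
open import Data.Product using (_×_; _,_)
open import Relation.Nullary using (¬_)
open import Relation.Nullary.Decidable using (⌊_⌋)

record ℚi : Set where
  constructor _+_i
  field
    re : ℚ
    im : ℚ
open ℚi public

infixl 6 _⊕_ _⊖_
infixl 7 _⊛_

_⊕_ : ℚi → ℚi → ℚi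
(a + b i) ⊕ (c + d i) = (a ℚ.+ c) + (b ℚ.+ d) i

_⊖_ : ℚi → ℚi → ℚi
(a + b i) ⊖ (c + d i) = (a ℚ.- c) + (b ℚ.- d) i

_⊛_ : ℚi → ℚi → ℚi
(a + b i) ⊛ (c + d i) = (a ℚ.* c ℚ.- b ℚ.* d) + (a ℚ.* d ℚ.+ b ℚ.* c) i

⟦_⟧ : ℚ → ℚi
⟦ a ⟧ = a + ℚ.0ℚ i

𝕚 : ℚi
𝕚 = ℚ.0ℚ + ℚ.1ℚ i

_^ⁱ_ : ℚi → ℕ → ℚi
x ^ⁱ zero = ⟦ ℚ.1ℚ ⟧
x ^ⁱ suc n = x ⊛ (x ^ⁱ n)

-- a / d for a natural number d (d = 0 never occurs below; it is sent to 0)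
frac : ℤ → ℕ → ℚ
frac a zero = ℚ.0ℚ
frac a (suc d) = a ℚ./ suc d

polylog : ℕ → ℕ → ℚi → ℚi
polylog p d x = foldr _⊕_ ⟦ ℚ.0ℚ ⟧ (map term (upTo p))
  where
  term : ℕ → ℚi
  term zero = ⟦ ℚ.0ℚ ⟧              -- k = 0 is not part of the sum
  term (suc j) = ⟦ frac (+ 1) (suc j ℕ.^ d) ⟧ ⊛ (x ^ⁱ suc j)

fermatQuotient : ℕ → ℕ → ℚ
fermatQuotient p a = frac (+ (a ℕ.^ (p ℕ.∸ 1)) ℤ.- + 1) p

-- Euler numbers: generating function sech t = Σ E_n t^n / n!,
-- i.e. E_0 = 1, E_n = 0 for n odd, and for n even, n ≥ 2,
--   Σ_{j=0}^{n} C(n,j) E_j = 0  (from sech t · cosh t = 1).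

private
  nextEuler : ℕ → List ℤ → ℤ
  nextEuler m prev =
    if (m ℕ.% 2) ℕ.≡ᵇ 0
    then ℤ.- foldr ℤ._+_ (+ 0) (map (λ { (j , e) → + (m C j) ℤ.* e }) (zip (upTo m) prev))
    else + 0

eulerUpTo : ℕ → List ℤ
eulerUpTo zero = + 1 ∷ []
eulerUpTo (suc n) = eulerUpTo n ++ (nextEuler (suc n) (eulerUpTo n) ∷ [])

eulerNumber : ℕ → ℤ
eulerNumber n = go (eulerUpTo n) n
  where
  go : List ℤ → ℕ → ℤ
  go [] _ = + 0
  go (e ∷ es) zero = e
  go (e ∷ es) (suc k) = go es k

divides? : ℕ → ℤ → Bool
divides? p a = ⌊ p ℕDiv.∣? ℤ.∣ a ∣ ⌋

isSquareMod : ℕ → ℤ → Bool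
isSquareMod p a = any (λ x → divides? p ((+ (x ℕ.* x)) ℤ.- a)) (upTo p)

legendre : ℤ → ℕ → ℤ
legendre a p =
  if divides? p a then + 0
  else (if isSquareMod p a then + 1 else ℤ.- (+ 1))

-- p-integrality and congruences in ℚ(i).
-- The ring of elements of ℚ(i) integral at all primes above p is
-- ℤ_(p)[i] = { a + b i : a, b ∈ ℚ with denominators prime to p }.

pIntegralℚ : ℕ → ℚ → Set
pIntegralℚ p q = ¬ (p ∣ ℚ.denominatorℕ q)

pIntegral : ℕ → ℚi → Set
pIntegral p z = pIntegralℚ p (re z) × pIntegralℚ p (im z)

_≡_[mod_] : ℚi → ℚi → ℕ → Set
a ≡ b [mod p ] = pIntegral p (⟦ frac (+ 1) p ⟧ ⊛ (a ⊖ b))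

{-# OPTIONS --safe #-}
module Submission where

-- All congruences are modulo p, ℓ = (-1/p), i stands for either square root of -1, and
-- H_k are the harmonic numbers.  Put G(x) = Σ H_(k-1) x^k / k over 0 < k < p.
--
-- Integrating the binomial theorem twice gives £₂(x) = - G(1 - x).  Expanding £₁(x) £₁(1/x)
-- by partial fractions and substituting k ↦ p - k gives Granville's congruence
--   £₁(x)² = - 2 (1 - x^p) £₂(1 - x) - 2 x^p £₂(x).
-- At x = - i it expresses £₂(1 + i) by £₁(- i) and £₂(- i).  Exactly, (1 + i)^p =
-- (1 + p s)(1 + ℓ i) with (1 + p s)² = 2^(p-1), so £₁(- i) = - s (1 + ℓ i) and q_p(2) = 2 s.
-- The symmetry £₂(- i) = - ℓ i £₂(i) reduces £₂(- i) to a sum of ± k^(p-3) over odd k,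
-- which telescopes by means of Euler polynomials to E_(p-3).  The second congruence follows
-- from the first by £₂(x) = x^p £₂(1/x).

open import Algebra.Bundles using (CommutativeRing)
open import Algebra.Solver.Ring.AlmostCommutativeRing as ACR using (_-Raw-AlmostCommutative⟶_)
open import Data.Bool using (Bool; true; false; T; if_then_else_)
open import Data.Integer as ℤ using (ℤ; +_; -[1+_])
import Data.Integer.Properties as ℤₚ
open import Data.Integer.Solver using () renaming (module +-*-Solver to ℤSolver)
open import Data.List using (List; []; _∷_; _++_; length; zip; upTo; map; foldr; applyUpTo)
open import Data.List.Membership.Propositional using (find; lose)
open import Data.List.Membership.Propositional.Properties using (∈-upTo⁺; ∈-upTo⁻)
import Data.List.Properties as Listₚ
open import Data.List.Relation.Unary.Any.Properties using (any⁺; any⁻)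
open import Data.Maybe using (Maybe; just; nothing)
open import Data.Nat as ℕ using (ℕ; zero; suc; _∸_; _<_; _≤_; z≤n; s≤s)
open import Data.Nat.Base using (_!)
open import Data.Nat.Combinatorics using (_C_; nCk+nC[k+1]≡[n+1]C[k+1]; nCn≡1; nC1≡n; k>n⇒nCk≡0)
open import Data.Nat.Divisibility using (_∣_; divides; ∣-trans; ∣⇒≤; _∣?_; ∣-refl)
open import Data.Nat.DivMod using (m%n<n; m≡m%n+[m/n]*n; [m+kn]%n≡m%n; m*n%n≡0)
open import Data.Nat.GCD using (gcd; gcd[m,n]∣m)
open import Data.Nat.Primality using (Prime; euclidsLemma; prime⇒irreducible; prime⇒nonTrivial)
import Data.Nat.Properties as ℕₚ
open import Data.Nat.Solver using (module +-*-Solver)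
open import Data.Product using (Σ; _×_; _,_; proj₁; proj₂)
open import Data.Rational as ℚ using (ℚ; 0ℚ; 1ℚ; ↧ₙ_; fromℚᵘ)
import Data.Rational.Properties as ℚₚ
import Data.Rational.Solver as ℚSolver
open import Data.Rational.Unnormalised as ℚᵘ using (ℚᵘ; mkℚᵘ; *≡*)
import Data.Rational.Unnormalised.Properties as ℚᵘₚ
open import Data.Sum using (_⊎_; inj₁; inj₂; [_,_]′)
open import Defs using (divides?; isSquareMod; legendre; eulerNumber; eulerUpTo)
open import Function using (_∘_; id)
open import Level using (0ℓ)
open import Relation.Binary.PropositionalEquality as ≡ using (_≡_)
open import Relation.Nullary using (¬_; yes; no; contradiction)
open import Relation.Nullary.Decidable using (toWitness; fromWitness)

-- Finite sums and binomial transforms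

-- The Fermat quotient is a quotient by p, so it cannot be formed in a ring where p = 0. The sum
-- identities are therefore proved over any commutative ring and used twice: in ℚ(i), where the p-th
-- power of 1 + i is computed and divided by p, and in the residue ring of p-integral elements, to
-- which only the quotient s is passed, together with its integrality. "Integrating" needs no
-- polynomials: C(p-1,k) ≡ (-1)^k makes £₂(x) a binomial transform of order p - 1, multiplication by
-- k is the derivative of such a transform, and going back is summation over the lower orders. At x
-- = - i Granville's congruence gives £₂(1 + i) the factor 1 + ℓ i. It is a unit because (1 + ℓ i)(1
-- - ℓ i) = 2, and £₂(- i) is known only after multiplication by the same factor, so the two fit
-- together. That p exceeds 3 is used to cancel 3 in the proof that £₂(1) ≡ 0, and to make p - 3
-- positive as well as even.

parity : ∀ n → Σ ℕ λ j → n ≡ j ℕ.+ j ⊎ n ≡ suc (j ℕ.+ j)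
parity zero    = 0 , inj₁ ≡.refl
parity (suc n) with parity n
... | j , inj₁ eq = j , inj₂ (≡.cong suc eq)
... | j , inj₂ eq = suc j , inj₁ (≡.cong suc (≡.trans eq (≡.sym (ℕₚ.+-suc j j))))

±1 : ℕ → ℤ
±1 zero    = + 1
±1 (suc m) = ℤ.- ±1 m

-- The sign with I^m (1 + I) = η m (1 + (-1)^m I) when I² = -1.
η : ℕ → ℤ
η zero    = + 1
η (suc m) = ℤ.- (±1 m ℤ.* η m)

η*η≡1 : ∀ m → η m ℤ.* η m ≡ + 1
η*η≡1 zero    = ≡.refl
η*η≡1 (suc m) = begin
  ℤ.- (±1 m ℤ.* η m) ℤ.* ℤ.- (±1 m ℤ.* η m)   ≡⟨ solve 2 (λ l e → (:- (l :* e)) :* (:- (l :* e)) := (l :* l) :* (e :* e)) ≡.refl (±1 m) (η m) ⟩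
  (±1 m ℤ.* ±1 m) ℤ.* (η m ℤ.* η m)           ≡⟨ ≡.cong₂ ℤ._*_ (±1*±1 m) (η*η≡1 m) ⟩
  + 1 ∎
  where
  open ≡.≡-Reasoning
  open ℤSolver using (solve; _:=_; _:*_; :-_)
  ±1*±1 : ∀ m → ±1 m ℤ.* ±1 m ≡ + 1
  ±1*±1 zero    = ≡.refl
  ±1*±1 (suc m) = ≡.trans (solve 1 (λ l → (:- l) :* (:- l) := l :* l) ≡.refl (±1 m)) (±1*±1 m)

-- The map is data instead of iterated addition of 1, so that in ℚ(i) the image of z is literally z
-- / 1, the form in which integers occur in the theorem.
record IntegersTo (R : CommutativeRing 0ℓ 0ℓ) : Set where
  open CommutativeRing R
  field
    φ       : ℤ → Carrier
    +-homo  : ∀ m n → φ (m ℤ.+ n) ≈ φ m + φ n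
    *-homo  : ∀ m n → φ (m ℤ.* n) ≈ φ m * φ n
    -‿homo  : ∀ m → φ (ℤ.- m) ≈ - φ m
    0-homo  : φ ℤ.0ℤ ≈ 0#
    1-homo  : φ ℤ.1ℤ ≈ 1#

module RingSums (R : CommutativeRing 0ℓ 0ℓ) (ℤ→R : IntegersTo R) where

  open CommutativeRing R public hiding (zero)
  open IntegersTo ℤ→R public
  open import Algebra.Properties.Semiring.Exp semiring public using (_^_; ^-congˡ; ^-homo-*)
  open import Algebra.Properties.CommutativeSemiring.Exp commutativeSemiring public using (^-distrib-*)
  open import Relation.Binary.Reasoning.Setoid setoid public

  private
    -- Agrees with φ, but makes the solver's constants 0 and 1 denote 0# and 1#.
    φ′ : ℤ → Carrier
    φ′ (+ 0) = 0#
    φ′ (+ 1) = 1#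
    φ′ m     = φ m

    φ′≈φ : ∀ m → φ′ m ≈ φ m
    φ′≈φ (+ 0)             = sym 0-homo
    φ′≈φ (+ 1)             = sym 1-homo
    φ′≈φ (+ suc (suc n))   = refl
    φ′≈φ -[1+ n ]          = refl

    morphism : ℤ.+-*-rawRing -Raw-AlmostCommutative⟶ ACR.fromCommutativeRing R
    morphism = record
      { ⟦_⟧    = φ′
      ; +-homo = λ m n → trans (φ′≈φ _) (trans (+-homo m n) (sym (+-cong (φ′≈φ m) (φ′≈φ n))))
      ; *-homo = λ m n → trans (φ′≈φ _) (trans (*-homo m n) (sym (*-cong (φ′≈φ m) (φ′≈φ n))))
      ; -‿homo = λ m → trans (φ′≈φ _) (trans (-‿homo m) (sym (-‿cong (φ′≈φ m))))
      ; 0-homo = refl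
      ; 1-homo = refl
      }

    coeff≟ : ∀ m n → Maybe (φ′ m ≈ φ′ n)
    coeff≟ m n with m ℤ.≟ n
    ... | yes ≡.refl = just refl
    ... | no _       = nothing

  open import Algebra.Solver.Ring ℤ.+-*-rawRing (ACR.fromCommutativeRing R) morphism coeff≟ public
    using (solve; con; _:=_; _:+_; _:*_; _:-_; :-_; Polynomial)

  ι : ℕ → Carrier
  ι n = φ (+ n)

  ι-suc : ∀ n → ι (suc n) ≈ 1# + ι n
  ι-suc n = trans (+-homo (+ 1) (+ n)) (+-congʳ 1-homo)

  :1 : ∀ {n} → Polynomial n
  :1 = con (+ 1)

  ι-* : ∀ m n → ι (m ℕ.* n) ≈ ι m * ι n
  ι-* m n = trans (reflexive (≡.cong φ (ℤₚ.pos-* m n))) (*-homo (+ m) (+ n))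

  ι-^ : ∀ m n → ι (m ℕ.^ n) ≈ ι m ^ n
  ι-^ m zero    = 1-homo
  ι-^ m (suc n) = trans (ι-* m (m ℕ.^ n)) (*-congˡ (ι-^ m n))

  ι2≈1+1 : ι 2 ≈ 1# + 1#
  ι2≈1+1 = trans (ι-suc 1) (+-congˡ 1-homo)

  φ-±1 : ∀ m → φ (±1 m) ≈ (- 1#) ^ m
  φ-±1 zero    = 1-homo
  φ-±1 (suc m) = trans (-‿homo (±1 m)) (trans (-‿cong (φ-±1 m)) (solve 1 (λ u → :- u := (:- :1) :* u) refl _))

  1^n≈1 : ∀ n → 1# ^ n ≈ 1#
  1^n≈1 zero    = refl
  1^n≈1 (suc n) = trans (*-identityˡ _) (1^n≈1 n)

  0^1+n≈0 : ∀ n → 0# ^ suc n ≈ 0#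
  0^1+n≈0 n = zeroˡ _

  Σ< : ℕ → (ℕ → Carrier) → Carrier
  Σ< zero    f = 0#
  Σ< (suc n) f = Σ< n f + f n

  Σ-cong : ∀ n {f g} → (∀ k → k < n → f k ≈ g k) → Σ< n f ≈ Σ< n g
  Σ-cong zero    eq = refl
  Σ-cong (suc n) eq = +-cong (Σ-cong n λ k k<n → eq k (ℕₚ.m<n⇒m<1+n k<n)) (eq n ℕₚ.≤-refl)

  Σ-+ : ∀ n f g → Σ< n (λ k → f k + g k) ≈ Σ< n f + Σ< n g
  Σ-+ zero    f g = sym (+-identityˡ 0#)
  Σ-+ (suc n) f g = trans (+-congʳ (Σ-+ n f g))
    (solve 4 (λ a b c d → (a :+ b) :+ (c :+ d) := (a :+ c) :+ (b :+ d)) refl _ _ _ _)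

  Σ-* : ∀ n c f → Σ< n (λ k → c * f k) ≈ c * Σ< n f
  Σ-* zero    c f = sym (zeroʳ c)
  Σ-* (suc n) c f = trans (+-congʳ (Σ-* n c f)) (sym (distribˡ c _ _))

  Σ-neg : ∀ n f → Σ< n (λ k → - f k) ≈ - Σ< n f
  Σ-neg n f = trans (Σ-cong n λ k _ → solve 1 (λ a → :- a := (:- :1) :* a) refl (f k))
    (trans (Σ-* n _ f) (solve 1 (λ a → (:- :1) :* a := :- a) refl _))

  Σ-zero : ∀ n {f} → (∀ k → k < n → f k ≈ 0#) → Σ< n f ≈ 0#
  Σ-zero zero    eq = refl
  Σ-zero (suc n) eq = trans (+-cong (Σ-zero n λ k k<n → eq k (ℕₚ.m<n⇒m<1+n k<n)) (eq n ℕₚ.≤-refl)) (+-identityˡ 0#)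

  Σ-head : ∀ n f → Σ< (suc n) f ≈ f 0 + Σ< n (f ∘ suc)
  Σ-head zero    f = +-comm 0# (f 0)
  Σ-head (suc n) f = trans (+-congʳ (Σ-head n f)) (+-assoc _ _ _)

  Σ-reverse : ∀ n f → Σ< n f ≈ Σ< n (λ k → f (n ∸ suc k))
  Σ-reverse zero    f = refl
  Σ-reverse (suc n) f = begin
    Σ< n f + f n                              ≈⟨ +-comm _ _ ⟩
    f n + Σ< n f                              ≈⟨ +-congˡ (Σ-reverse n f) ⟩
    f n + Σ< n (λ k → f (n ∸ suc k))          ≈⟨ Σ-head n (λ k → f (suc n ∸ suc k)) ⟨
    Σ< (suc n) (λ k → f (suc n ∸ suc k))      ∎

  -- For summands vanishing at 0, the substitution k ↦ n - k on 0 < k < n.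
  Σ-reflect : ∀ n {f g} → f 0 ≈ 0# → g 0 ≈ 0# →
              (∀ k → 0 < k → k < n → f (n ∸ k) ≈ g k) → Σ< n f ≈ Σ< n g
  Σ-reflect zero          f0 g0 eq = refl
  Σ-reflect (suc n) {f} {g} f0 g0 eq = begin
    Σ< (suc n) f                          ≈⟨ Σ-head n f ⟩
    f 0 + Σ< n (f ∘ suc)                  ≈⟨ +-cong (trans f0 (sym g0)) (Σ-reverse n (f ∘ suc)) ⟩
    g 0 + Σ< n (λ k → f (suc (n ∸ suc k))) ≈⟨ +-congˡ (Σ-cong n λ k k<n →
        trans (reflexive (≡.cong f (≡.sym (ℕₚ.+-∸-assoc 1 k<n)))) (eq (suc k) (s≤s z≤n) (s≤s k<n))) ⟩
    g 0 + Σ< n (g ∘ suc)                  ≈⟨ Σ-head n g ⟨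
    Σ< (suc n) g                          ∎

  -- B t n b = Σ_j C(n,j) t^(n-j) b_j: the operator (S + t)^n, S the shift, evaluated at index 0.
  B : Carrier → ℕ → (ℕ → Carrier) → Carrier
  B t zero    b = b 0
  B t (suc n) b = B t n (λ k → b (suc k) + t * b k)

  B-cong : ∀ t n {a b} → (∀ k → k ≤ n → a k ≈ b k) → B t n a ≈ B t n b
  B-cong t zero    eq = eq 0 z≤n
  B-cong t (suc n) eq = B-cong t n λ k k≤n → +-cong (eq (suc k) (s≤s k≤n)) (*-congˡ (eq k (ℕₚ.m≤n⇒m≤1+n k≤n)))

  B-congₜ : ∀ {s t} n b → s ≈ t → B s n b ≈ B t n b
  B-congₜ zero    b eq = refl
  B-congₜ {s} {t} (suc n) b eq = trans (B-congₜ n _ eq) (B-cong t n λ k _ → +-congˡ (*-congʳ eq))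

  B-+ : ∀ t n a b → B t n (λ k → a k + b k) ≈ B t n a + B t n b
  B-+ t zero    a b = refl
  B-+ t (suc n) a b = trans (B-cong t n λ k _ →
      solve 5 (λ a a′ b b′ t → (a′ :+ b′) :+ t :* (a :+ b) := (a′ :+ t :* a) :+ (b′ :+ t :* b)) refl (a k) (a (suc k)) (b k) (b (suc k)) t)
    (B-+ t n _ _)

  B-* : ∀ t n c a → B t n (λ k → c * a k) ≈ c * B t n a
  B-* t zero    c a = refl
  B-* t (suc n) c a = trans (B-cong t n λ k _ →
      solve 4 (λ a a′ c t → c :* a′ :+ t :* (c :* a) := c :* (a′ :+ t :* a)) refl (a k) (a (suc k)) c t)
    (B-* t n c _)

  -- Umbrally, ((a + t) + s)^n = (a + (s + t))^n.
  B-comp : ∀ s t n a → B s n (λ k → B t k a) ≈ B (s + t) n a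
  B-comp s t zero    a = refl
  B-comp s t (suc n) a = begin
    B s n (λ k → B t k (λ j → a (suc j) + t * a j) + s * B t k a)
      ≈⟨ B-cong s n (λ k _ → trans (+-congˡ (sym (B-* t k s a))) (sym (B-+ t k _ _))) ⟩
    B s n (λ k → B t k (λ j → (a (suc j) + t * a j) + s * a j))
      ≈⟨ B-comp s t n _ ⟩
    B (s + t) n (λ j → (a (suc j) + t * a j) + s * a j)
      ≈⟨ B-cong (s + t) n (λ j _ → solve 4 (λ a a′ s t → (a′ :+ t :* a) :+ s :* a := a′ :+ (s :+ t) :* a) refl (a j) (a (suc j)) s t) ⟩
    B (s + t) n (λ j → a (suc j) + (s + t) * a j) ∎

  B-pow : ∀ t n x → B t n (x ^_) ≈ (x + t) ^ n
  B-pow t zero    x = refl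
  B-pow t (suc n) x = begin
    B t n (λ k → x * x ^ k + t * x ^ k)   ≈⟨ B-cong t n (λ k _ → sym (distribʳ _ x t)) ⟩
    B t n (λ k → (x + t) * x ^ k)         ≈⟨ B-* t n (x + t) _ ⟩
    (x + t) * B t n (x ^_)                ≈⟨ *-congˡ (B-pow t n x) ⟩
    (x + t) * (x + t) ^ n                 ∎

  -- Multiplication by the index plays the role of the derivative.
  B-index : ∀ t n b → B t (suc n) (λ k → ι k * b k) ≈ ι (suc n) * B t n (b ∘ suc)
  B-index t zero b = begin
    ι 1 * b 1 + t * (ι 0 * b 0)   ≈⟨ +-congˡ (*-congˡ (*-congʳ 0-homo)) ⟩
    ι 1 * b 1 + t * (0# * b 0)    ≈⟨ +-congˡ (trans (*-congˡ (zeroˡ _)) (zeroʳ t)) ⟩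
    ι 1 * b 1 + 0#                ≈⟨ +-identityʳ _ ⟩
    ι 1 * b 1 ∎
  B-index t (suc n) b = begin
    B t (suc n) (λ k → ι (suc k) * b (suc k) + t * (ι k * b k))
      ≈⟨ B-cong t (suc n) (λ k _ → trans (+-congʳ (*-congʳ (ι-suc k)))
           (solve 4 (λ i t b b′ → (:1 :+ i) :* b′ :+ t :* (i :* b) := (i :* b′ :+ t :* (i :* b)) :+ b′) refl (ι k) t (b k) (b (suc k)))) ⟩
    B t (suc n) (λ k → (ι k * b (suc k) + t * (ι k * b k)) + b (suc k))
      ≈⟨ trans (B-+ t (suc n) _ _) (+-congʳ (trans (B-+ t (suc n) _ _) (+-congˡ (B-* t (suc n) t _)))) ⟩
    (B t (suc n) (λ k → ι k * b (suc k)) + t * B t (suc n) (λ k → ι k * b k)) + B t (suc n) (b ∘ suc)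
      ≈⟨ +-congʳ (+-cong (B-index t n (b ∘ suc)) (*-congˡ (B-index t n b))) ⟩
    (ι (suc n) * B t n (b ∘ suc ∘ suc) + t * (ι (suc n) * B t n (b ∘ suc))) + B t (suc n) (b ∘ suc)
      ≈⟨ +-congʳ (solve 4 (λ i t a b → i :* a :+ t :* (i :* b) := i :* (a :+ t :* b)) refl _ _ _ _) ⟩
    ι (suc n) * (B t n (b ∘ suc ∘ suc) + t * B t n (b ∘ suc)) + B t (suc n) (b ∘ suc)
      ≈⟨ +-congʳ (*-congˡ (trans (+-congˡ (sym (B-* t n t _))) (sym (B-+ t n _ _)))) ⟩
    ι (suc n) * B t (suc n) (b ∘ suc) + B t (suc n) (b ∘ suc)
      ≈⟨ solve 2 (λ i a → i :* a :+ a := (:1 :+ i) :* a) refl _ _ ⟩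
    (1# + ι (suc n)) * B t (suc n) (b ∘ suc)
      ≈⟨ *-congʳ (ι-suc (suc n)) ⟨
    ι (suc (suc n)) * B t (suc n) (b ∘ suc) ∎

  binomialSum : ℕ → (ℕ → Carrier) → Carrier
  binomialSum n b = Σ< (suc n) (λ k → ι (n C k) * b k)

  B-binomial : ∀ n b → B 1# n b ≈ binomialSum n b
  B-binomial zero    b = sym (trans (+-identityˡ _) (trans (*-congʳ 1-homo) (*-identityˡ _)))
  B-binomial (suc n) b = begin
    B 1# n (λ k → b (suc k) + 1# * b k)
      ≈⟨ B-binomial n _ ⟩
    Σ< (suc n) (λ k → ι (n C k) * (b (suc k) + 1# * b k))
      ≈⟨ trans (Σ-cong (suc n) λ k _ → solve 3 (λ c b b′ → c :* (b′ :+ :1 :* b) := c :* b′ :+ c :* b) refl (ι (n C k)) (b k) (b (suc k)))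
               (Σ-+ (suc n) _ _) ⟩
    Σ< (suc n) (λ k → ι (n C k) * b (suc k)) + Σ< (suc n) (λ k → ι (n C k) * b k)
      ≈⟨ +-congˡ (trans (sym (+-identityʳ _)) (trans (+-congˡ (sym top)) (Σ-head (suc n) (λ k → ι (n C k) * b k)))) ⟩
    Σ< (suc n) (λ k → ι (n C k) * b (suc k)) + (ι (n C 0) * b 0 + Σ< (suc n) (λ k → ι (n C suc k) * b (suc k)))
      ≈⟨ solve 3 (λ x y z → x :+ (y :+ z) := y :+ (x :+ z)) refl _ _ _ ⟩
    ι (n C 0) * b 0 + (Σ< (suc n) (λ k → ι (n C k) * b (suc k)) + Σ< (suc n) (λ k → ι (n C suc k) * b (suc k)))
      ≈⟨ +-congˡ (trans (sym (Σ-+ (suc n) _ _)) (Σ-cong (suc n) λ k _ → pascal k)) ⟩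
    ι (suc n C 0) * b 0 + Σ< (suc n) (λ k → ι (suc n C suc k) * b (suc k))
      ≈⟨ Σ-head (suc n) (λ k → ι (suc n C k) * b k) ⟨
    binomialSum (suc n) b ∎
    where
    top : ι (n C suc n) * b (suc n) ≈ 0#
    top = trans (*-congʳ (trans (reflexive (≡.cong ι (k>n⇒nCk≡0 (ℕₚ.n<1+n n)))) 0-homo)) (zeroˡ _)
    pascal : ∀ k → ι (n C k) * b (suc k) + ι (n C suc k) * b (suc k) ≈ ι (suc n C suc k) * b (suc k)
    pascal k = trans (sym (distribʳ _ _ _)) (*-congʳ (trans (sym (+-homo _ _))
                 (reflexive (≡.cong ι (nCk+nC[k+1]≡[n+1]C[k+1] n k)))))

  -1# : Carrier
  -1# = - 1#

  -1*-1≈1 : -1# * -1# ≈ 1#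
  -1*-1≈1 = solve 0 ((:- :1) :* (:- :1) := :1) refl

  x^[m+m] : ∀ x m → x ^ (m ℕ.+ m) ≈ (x * x) ^ m
  x^[m+m] x m = trans (^-homo-* x m m) (sym (^-distrib-* x x m))

  -1^[m+m]≈1 : ∀ m → -1# ^ (m ℕ.+ m) ≈ 1#
  -1^[m+m]≈1 m = trans (x^[m+m] -1# m) (trans (^-congˡ m -1*-1≈1) (1^n≈1 m))

  ±1*±1≈1 : ∀ m → -1# ^ m * -1# ^ m ≈ 1#
  ±1*±1≈1 m = trans (sym (^-homo-* -1# m m)) (-1^[m+m]≈1 m)

  -- Twisting a sequence by (-1)^k turns the shift S into - S, hence S + t into - (S - t).
  B-neg : ∀ t n b → B (- t) n b ≈ -1# ^ n * B t n (λ k → -1# ^ k * b k)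
  B-neg t zero    b = solve 1 (λ b → b := :1 :* (:1 :* b)) refl (b 0)
  B-neg t (suc n) b = begin
    B (- t) n (λ k → b (suc k) + - t * b k)
      ≈⟨ B-neg t n _ ⟩
    -1# ^ n * B t n (λ k → -1# ^ k * (b (suc k) + - t * b k))
      ≈⟨ *-congˡ (B-cong t n λ k _ → solve 4 (λ s b′ t b → s :* (b′ :+ (:- t) :* b) := (:- :1) :* ((:- :1 :* s) :* b′ :+ t :* (s :* b))) refl (-1# ^ k) (b (suc k)) t (b k)) ⟩
    -1# ^ n * B t n (λ k → -1# * (-1# ^ suc k * b (suc k) + t * (-1# ^ k * b k)))
      ≈⟨ *-congˡ (B-* t n -1# _) ⟩
    -1# ^ n * (-1# * B t (suc n) (λ k → -1# ^ k * b k))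
      ≈⟨ solve 3 (λ s i x → s :* (i :* x) := (i :* s) :* x) refl _ _ _ ⟩
    -1# ^ suc n * B t (suc n) (λ k → -1# ^ k * b k) ∎

  -- Up to sign, B 1 n (f k (-1)^k) is the n-th finite difference of f.
  difference-step : ∀ r n c → B 1# (suc n) (λ k → (ι k + c) ^ suc r * -1# ^ k) ≈
    ι (suc n) * (-1# * B 1# n (λ k → (ι k + (1# + c)) ^ r * -1# ^ k)) + c * B 1# (suc n) (λ k → (ι k + c) ^ r * -1# ^ k)
  difference-step r n c = begin
    B 1# (suc n) (λ k → (ι k + c) ^ suc r * -1# ^ k)
      ≈⟨ B-cong 1# (suc n) (λ k _ → solve 4 (λ i c x s → ((i :+ c) :* x) :* s := i :* (x :* s) :+ c :* (x :* s)) refl (ι k) c ((ι k + c) ^ r) (-1# ^ k)) ⟩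
    B 1# (suc n) (λ k → ι k * f k + c * f k)
      ≈⟨ trans (B-+ 1# (suc n) _ _) (+-cong (B-index 1# n f) (B-* 1# (suc n) c f)) ⟩
    ι (suc n) * B 1# n (f ∘ suc) + c * B 1# (suc n) f
      ≈⟨ +-congʳ (*-congˡ (trans (B-cong 1# n λ k _ → trans (*-congʳ (^-congˡ r (trans (+-congʳ (ι-suc k)) (solve 2 (λ i c → (:1 :+ i) :+ c := i :+ (:1 :+ c)) refl _ _))))
                                                            (solve 3 (λ x i s → x :* (i :* s) := i :* (x :* s)) refl _ _ _))
                                 (B-* 1# n -1# _))) ⟩
    ι (suc n) * (-1# * B 1# n (λ k → (ι k + (1# + c)) ^ r * -1# ^ k)) + c * B 1# (suc n) f ∎
    where
    f : ℕ → Carrier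
    f k = (ι k + c) ^ r * -1# ^ k

  -- The n-th difference kills polynomials of degree below n. The offset `c` has to be general,
  -- since `B-index` shifts the sequence and so replaces `c` by 1 + c.
  difference-< : ∀ r n c → r < n → B 1# n (λ k → (ι k + c) ^ r * -1# ^ k) ≈ 0#
  difference-< zero (suc n) c _ = begin
    B 1# (suc n) (λ k → 1# * -1# ^ k) ≈⟨ B-cong 1# (suc n) (λ k _ → *-identityˡ _) ⟩
    B 1# (suc n) (-1# ^_)             ≈⟨ B-pow 1# (suc n) -1# ⟩
    (-1# + 1#) ^ suc n                ≈⟨ trans (*-congʳ (-‿inverseˡ 1#)) (zeroˡ _) ⟩
    0# ∎
  difference-< (suc r) (suc n) c (s≤s r<n) = trans (difference-step r n c)
    (trans (+-cong (*-congˡ (*-congˡ (difference-< r n (1# + c) r<n))) (*-congˡ (difference-< r (suc n) c (ℕₚ.m<n⇒m<1+n r<n))))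
           (solve 3 (λ i j c → i :* (j :* con (+ 0)) :+ c :* con (+ 0) := con (+ 0)) refl _ _ _))

  difference-≡ : ∀ n c → B 1# n (λ k → (ι k + c) ^ n * -1# ^ k) ≈ -1# ^ n * ι (n !)
  difference-≡ zero    c = *-congˡ (sym 1-homo)
  difference-≡ (suc n) c = begin
    B 1# (suc n) (λ k → (ι k + c) ^ suc n * -1# ^ k)
      ≈⟨ trans (difference-step n n c) (+-cong (*-congˡ (*-congˡ (difference-≡ n (1# + c)))) (*-congˡ (difference-< n (suc n) c ℕₚ.≤-refl))) ⟩
    ι (suc n) * (-1# * (-1# ^ n * ι (n !))) + c * 0#
      ≈⟨ solve 5 (λ i j s f c → i :* (j :* (s :* f)) :+ c :* con (+ 0) := (j :* s) :* (i :* f)) refl _ _ _ _ _ ⟩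
    -1# ^ suc n * (ι (suc n) * ι (n !))
      ≈⟨ *-congˡ (ι-* (suc n) (n !)) ⟨
    -1# ^ suc n * ι (suc n !) ∎

  -- With p = n + 1 this is C(p,k+1) = p C(p-1,k) / (k+1). It is meant for characteristic 0, where
  -- it exhibits ((x + 1)^p - 1 - x^p) / p as a sum with p-integral coefficients.
  p*binomialSum : ∀ n (a : ℕ → Carrier) x → (∀ k → ι (suc k) * a (suc k) ≈ 1#) →
    ι (suc n) * Σ< n (λ k → ι (n C k) * (a (suc k) * x ^ suc k)) ≈ ((x + 1#) ^ suc n - 1#) - x ^ suc n
  p*binomialSum n a x a-inverse = begin
    ι (suc n) * S
      ≈⟨ solve 3 (λ i s t → i :* s := i :* (s :+ t) :- i :* t) refl _ _ _ ⟩
    ι (suc n) * (S + ι (n C n) * b (suc n)) - ι (suc n) * (ι (n C n) * b (suc n))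
      ≈⟨ +-cong (*-congˡ (sym (B-binomial n (b ∘ suc)))) (-‿cong (*-congˡ (trans (*-congʳ (trans (reflexive (≡.cong ι (nCn≡1 n))) 1-homo)) (*-identityˡ _)))) ⟩
    ι (suc n) * B 1# n (b ∘ suc) - ι (suc n) * b (suc n)
      ≈⟨ +-cong (sym (B-index 1# n b)) (-‿cong (cancel n)) ⟩
    B 1# (suc n) (λ k → ι k * b k) - x ^ suc n
      -- Whatever `a 0` is, k b_k vanishes at k = 0, so k b_k = x^k - 0^k; the transform of 0^k is
      -- the 1 that gets subtracted.
      ≈⟨ +-congʳ (B-cong 1# (suc n) λ { zero _ → trans (*-congʳ 0-homo) (solve 1 (λ b → con (+ 0) :* b := :1 :+ (:- :1) :* :1) refl _)
                                      ; (suc k) _ → trans (cancel k) (trans (solve 1 (λ u → u := u :+ (:- :1) :* con (+ 0)) refl _) (+-congˡ (*-congˡ (sym (0^1+n≈0 k))))) }) ⟩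
    B 1# (suc n) (λ k → x ^ k + -1# * 0# ^ k) - x ^ suc n
      ≈⟨ +-congʳ (trans (B-+ 1# (suc n) _ _) (+-cong (B-pow 1# (suc n) x) (trans (B-* 1# (suc n) -1# _)
           (trans (*-congˡ (trans (B-pow 1# (suc n) 0#) (trans (^-congˡ (suc n) (+-identityˡ _)) (1^n≈1 (suc n))))) (*-identityʳ _))))) ⟩
    ((x + 1#) ^ suc n - 1#) - x ^ suc n ∎
    where
    b : ℕ → Carrier
    b k = a k * x ^ k
    S = Σ< n (λ k → ι (n C k) * b (suc k))
    cancel : ∀ k → ι (suc k) * b (suc k) ≈ x ^ suc k
    cancel k = trans (sym (*-assoc _ _ _)) (trans (*-congʳ (a-inverse k)) (*-identityˡ _))

  -- Powers of a square root of -1 and of 1 + I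

  module SquareRootOf-1 (I : Carrier) (I²≈-1 : I * I ≈ -1#) where

    I^[m+m] : ∀ m → I ^ (m ℕ.+ m) ≈ -1# ^ m
    I^[m+m] m = trans (x^[m+m] I m) (^-congˡ m I²≈-1)

    I^[1+m+m] : ∀ m → I ^ suc (m ℕ.+ m) ≈ -1# ^ m * I
    I^[1+m+m] m = trans (*-congˡ (I^[m+m] m)) (*-comm _ _)

    I^m*[I+1] : ∀ m → I ^ m * (I + 1#) ≈ φ (η m) * (1# + -1# ^ m * I)
    I^m*[I+1] zero    = trans (solve 1 (λ i → :1 :* (i :+ :1) := :1 :* (:1 :+ :1 :* i)) refl I) (*-congʳ (sym 1-homo))
    I^m*[I+1] (suc m) = begin
      (I * I ^ m) * (I + 1#)
        ≈⟨ *-assoc _ _ _ ⟩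
      I * (I ^ m * (I + 1#))
        ≈⟨ *-congˡ (I^m*[I+1] m) ⟩
      I * (φ (η m) * (1# + l * I))
        ≈⟨ solve 3 (λ i e l → i :* (e :* (:1 :+ l :* i)) := e :* (:1 :* i :+ l :* (i :* i))) refl _ _ _ ⟩
      φ (η m) * (1# * I + l * (I * I))
        ≈⟨ *-congˡ (+-cong (*-congʳ (sym (±1*±1≈1 m))) (*-congˡ I²≈-1)) ⟩
      φ (η m) * ((l * l) * I + l * -1#)
        ≈⟨ solve 3 (λ e l i → e :* ((l :* l) :* i :+ l :* (:- :1)) := (:- (l :* e)) :* (:1 :+ (:- :1 :* l) :* i)) refl _ _ _ ⟩
      (- (l * φ (η m))) * (1# + -1# ^ suc m * I)
        ≈⟨ *-congʳ (trans (-‿homo _) (-‿cong (trans (*-homo _ _) (*-congʳ (φ-±1 m))))) ⟨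
      φ (η (suc m)) * (1# + -1# ^ suc m * I) ∎
      where l = -1# ^ m

    -- Since (1 + I)² = 2 I, this power is 2^m I^m (1 + I). For p = 2 m + 1 the square of the
    -- integer factor is 2^(p-1), which links it to the Fermat quotient of 2.
    [I+1]^[1+m+m] : ∀ m → (I + 1#) ^ suc (m ℕ.+ m) ≈ φ (η m ℤ.* + (2 ℕ.^ m)) * (1# + -1# ^ m * I)
    [I+1]^[1+m+m] m = begin
      (I + 1#) * (I + 1#) ^ (m ℕ.+ m)        ≈⟨ *-congˡ (trans (x^[m+m] _ m) (^-congˡ m [I+1]²)) ⟩
      (I + 1#) * (ι 2 * I) ^ m               ≈⟨ *-congˡ (trans (^-distrib-* _ _ m) (*-congʳ (sym (ι-^ 2 m)))) ⟩
      (I + 1#) * (ι (2 ℕ.^ m) * I ^ m)       ≈⟨ solve 3 (λ u t v → u :* (t :* v) := t :* (v :* u)) refl _ _ _ ⟩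
      ι (2 ℕ.^ m) * (I ^ m * (I + 1#))       ≈⟨ *-congˡ (I^m*[I+1] m) ⟩
      ι (2 ℕ.^ m) * (φ (η m) * (1# + -1# ^ m * I)) ≈⟨ solve 3 (λ t e w → t :* (e :* w) := (e :* t) :* w) refl _ _ _ ⟩
      (φ (η m) * ι (2 ℕ.^ m)) * (1# + -1# ^ m * I) ≈⟨ *-congʳ (*-homo _ _) ⟨
      φ (η m ℤ.* + (2 ℕ.^ m)) * (1# + -1# ^ m * I) ∎
      where
      [I+1]² : (I + 1#) * (I + 1#) ≈ ι 2 * I
      [I+1]² = begin
        (I + 1#) * (I + 1#)          ≈⟨ solve 1 (λ i → (i :+ :1) :* (i :+ :1) := i :* i :+ ((:1 :+ :1) :* i :+ :1)) refl I ⟩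
        I * I + ((1# + 1#) * I + 1#) ≈⟨ +-congʳ I²≈-1 ⟩
        -1# + ((1# + 1#) * I + 1#)   ≈⟨ solve 1 (λ i → (:- :1) :+ ((:1 :+ :1) :* i :+ :1) := (:1 :+ :1) :* i) refl I ⟩
        (1# + 1#) * I                ≈⟨ *-congʳ ι2≈1+1 ⟨
        ι 2 * I ∎

  -- Umbrally (E + 1)^n + (E - 1)^n is 2 if n = 0 and 0 otherwise, and F t = (E + t)^n satisfies F (t + 1) + F (t - 1) = 2 t^n.
  module Euler (E : ℕ → Carrier) (E0≈1 : E 0 ≈ 1#) (E-odd : ∀ j → E (suc (j ℕ.+ j)) ≈ 0#)
               (E-even : ∀ j → binomialSum (suc j ℕ.+ suc j) E ≈ 0#) where

    [-1]^k*E : ∀ k → -1# ^ k * E k ≈ E k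
    [-1]^k*E k with parity k
    ... | j , inj₁ ≡.refl = trans (*-congʳ (-1^[m+m]≈1 j)) (*-identityˡ _)
    ... | j , inj₂ ≡.refl = trans (*-congˡ (E-odd j)) (trans (zeroʳ _) (sym (E-odd j)))

    B[-1] : ∀ n → B -1# n E ≈ -1# ^ n * B 1# n E
    B[-1] n = trans (B-neg 1# n E) (*-congˡ (B-cong 1# n λ k _ → [-1]^k*E k))

    B[1]-even : ∀ j → B 1# (suc j ℕ.+ suc j) E ≈ 0#
    B[1]-even j = trans (B-binomial _ E) (E-even j)

    -- The coefficients of sech u (e^u + e^(-u)) = 2.
    B[1]+B[-1] : ∀ n → B 1# n E + B -1# n E ≈ (1# + 1#) * 0# ^ n
    B[1]+B[-1] n with parity n
    ... | zero , inj₁ ≡.refl = trans (+-cong E0≈1 E0≈1) (sym (*-identityʳ _))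
    ... | suc j , inj₁ ≡.refl = trans (+-cong (B[1]-even j) (trans (B[-1] (suc j ℕ.+ suc j)) (trans (*-congˡ (B[1]-even j)) (zeroʳ _))))
                                      (trans (+-identityˡ _) (sym (trans (*-congˡ (0^1+n≈0 (j ℕ.+ suc j))) (zeroʳ _))))
    ... | j , inj₂ ≡.refl = trans (+-congˡ (trans (B[-1] (suc (j ℕ.+ j))) (*-congʳ (trans (*-congˡ (-1^[m+m]≈1 j)) (*-identityʳ _)))))
                                  (trans (solve 1 (λ b → b :+ (:- :1) :* b := con (+ 0)) refl _) (sym (trans (*-congˡ (0^1+n≈0 (j ℕ.+ j))) (zeroʳ _))))

    -- In terms of the Euler polynomial this is 2^n E_n((t + 1)/2); the rescaling keeps the
    -- coefficients integral.
    F : ℕ → Carrier → Carrier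
    F n t = B t n E

    -- By `B-comp`, both terms on the left are transforms with parameter t of the umbral values at 1
    -- and -1. These add up to 2 times 0^k, whose transform is t^n.
    F-equation : ∀ n t → F n (t + 1#) + F n (t - 1#) ≈ (1# + 1#) * t ^ n
    F-equation n t = begin
      B (t + 1#) n E + B (t - 1#) n E             ≈⟨ +-cong (sym (B-comp t 1# n E)) (sym (B-comp t -1# n E)) ⟩
      B t n (λ k → B 1# k E) + B t n (λ k → B -1# k E) ≈⟨ B-+ t n _ _ ⟨
      B t n (λ k → B 1# k E + B -1# k E)          ≈⟨ B-cong t n (λ k _ → B[1]+B[-1] k) ⟩
      B t n (λ k → (1# + 1#) * 0# ^ k)            ≈⟨ B-* t n _ _ ⟩
      (1# + 1#) * B t n (0# ^_)                   ≈⟨ *-congˡ (trans (B-pow t n 0#) (^-congˡ n (+-identityˡ t))) ⟩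
      (1# + 1#) * t ^ n ∎

    F[0] : ∀ n → F n 0# ≈ E n
    F[0] n = trans (shift n E) (reflexive (≡.cong E (ℕₚ.+-identityʳ n)))
      where
      shift : ∀ n b → B 0# n b ≈ b (n ℕ.+ 0)
      shift zero    b = refl
      shift (suc n) b = trans (B-cong 0# n λ k _ → trans (+-congˡ (zeroˡ _)) (+-identityʳ _)) (shift n (b ∘ suc))

    F[-1]-even : ∀ j → F (suc j ℕ.+ suc j) -1# ≈ 0#
    F[-1]-even j = trans (B[-1] (suc j ℕ.+ suc j)) (trans (*-congˡ (B[1]-even j)) (zeroʳ _))

[1+k]*[1+n]C[1+k]≡[1+n]*nCk : ∀ n k → suc k ℕ.* (suc n C suc k) ≡ suc n ℕ.* (n C k)
[1+k]*[1+n]C[1+k]≡[1+n]*nCk n       zero    = ≡.trans (ℕₚ.*-identityˡ _) (≡.trans (nC1≡n (suc n)) (≡.sym (ℕₚ.*-identityʳ _)))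
[1+k]*[1+n]C[1+k]≡[1+n]*nCk zero    (suc k) = ℕₚ.*-zeroʳ (suc (suc k))
[1+k]*[1+n]C[1+k]≡[1+n]*nCk (suc n) (suc k) = begin
  suc (suc k) ℕ.* (suc (suc n) C suc (suc k))
    ≡⟨ ≡.cong (suc (suc k) ℕ.*_) (≡.sym (nCk+nC[k+1]≡[n+1]C[k+1] (suc n) (suc k))) ⟩
  suc (suc k) ℕ.* (c ℕ.+ (suc n C suc (suc k)))
    ≡⟨ ℕS.solve 3 (λ k c d → (ℕS.con 1 ℕS.:+ k) ℕS.:* (c ℕS.:+ d) ℕS.:= (c ℕS.:+ k ℕS.:* c) ℕS.:+ (ℕS.con 1 ℕS.:+ k) ℕS.:* d) ≡.refl (suc k) c _ ⟩
  (c ℕ.+ suc k ℕ.* c) ℕ.+ suc (suc k) ℕ.* (suc n C suc (suc k))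
    ≡⟨ ≡.cong₂ (λ u v → (c ℕ.+ u) ℕ.+ v) ([1+k]*[1+n]C[1+k]≡[1+n]*nCk n k) ([1+k]*[1+n]C[1+k]≡[1+n]*nCk n (suc k)) ⟩
  (c ℕ.+ suc n ℕ.* (n C k)) ℕ.+ suc n ℕ.* (n C suc k)
    ≡⟨ ℕS.solve 4 (λ c n d e → (c ℕS.:+ n ℕS.:* d) ℕS.:+ n ℕS.:* e ℕS.:= c ℕS.:+ n ℕS.:* (d ℕS.:+ e)) ≡.refl c (suc n) (n C k) (n C suc k) ⟩
  c ℕ.+ suc n ℕ.* ((n C k) ℕ.+ (n C suc k))
    ≡⟨ ≡.cong (λ u → c ℕ.+ suc n ℕ.* u) (nCk+nC[k+1]≡[n+1]C[k+1] n k) ⟩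
  suc (suc n) ℕ.* c ∎
  where
  open ≡.≡-Reasoning
  module ℕS = +-*-Solver
  c = suc n C suc k

-- Characteristic p = suc n; a k is the inverse of k for 0 < k < p.
module CharacteristicP (R : CommutativeRing 0ℓ 0ℓ) (ℤ→R : IntegersTo R) (n : ℕ)
  (a : ℕ → CommutativeRing.Carrier R)
  (p≈0 : CommutativeRing._≈_ R (IntegersTo.φ ℤ→R (+ suc n)) (CommutativeRing.0# R))
  (a0≈0 : CommutativeRing._≈_ R (a 0) (CommutativeRing.0# R))
  (a-inverse : ∀ k → 0 < k → k < suc n → CommutativeRing._≈_ R (CommutativeRing._*_ R (IntegersTo.φ ℤ→R (+ k)) (a k)) (CommutativeRing.1# R))
  (3≤n : 3 ≤ n) where

  open RingSums R ℤ→R public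

  p : ℕ
  p = suc n

  ι-cancel : ∀ k {x} → 0 < k → k < p → ι k * x ≈ 0# → x ≈ 0#
  ι-cancel k {x} 0<k k<p eq = begin
    x               ≈⟨ *-identityˡ x ⟨
    1# * x          ≈⟨ *-congʳ (trans (sym (a-inverse k 0<k k<p)) (*-comm _ _)) ⟩
    a k * ι k * x   ≈⟨ *-assoc _ _ _ ⟩
    a k * (ι k * x) ≈⟨ trans (*-congˡ eq) (zeroʳ _) ⟩
    0# ∎

  ι3≈1+1+1 : ι 3 ≈ 1# + (1# + 1#)
  ι3≈1+1+1 = trans (ι-suc 2) (+-congˡ ι2≈1+1)

  2<p : 2 < p
  2<p = ℕₚ.m≤n⇒m≤1+n 3≤n

  double-cancel : ∀ {x} → x + x ≈ 0# → x ≈ 0#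
  double-cancel {x} eq = ι-cancel 2 (s≤s z≤n) 2<p
    (trans (*-congʳ ι2≈1+1) (trans (solve 1 (λ x → (:1 :+ :1) :* x := x :+ x) refl x) eq))

  ι-∸ : ∀ k → k ≤ p → ι (p ∸ k) ≈ - ι k
  ι-∸ k k≤p = begin
    ι (p ∸ k)                 ≈⟨ solve 2 (λ u v → u := (u :+ v) :- v) refl _ _ ⟩
    (ι (p ∸ k) + ι k) - ι k   ≈⟨ +-congʳ (trans (sym (+-homo _ _)) (trans (reflexive (≡.cong ι (ℕₚ.m∸n+n≡m k≤p))) p≈0)) ⟩
    0# - ι k                  ≈⟨ +-identityˡ _ ⟩
    - ι k ∎

  a-reflect : ∀ k → 0 < k → k < p → a (p ∸ k) ≈ - a k
  a-reflect k 0<k k<p = begin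
    a (p ∸ k)                       ≈⟨ *-identityʳ _ ⟨
    a (p ∸ k) * 1#                  ≈⟨ *-congˡ (a-inverse k 0<k k<p) ⟨
    a (p ∸ k) * (ι k * a k)         ≈⟨ solve 3 (λ u v w → u :* (v :* w) := :- (((:- v) :* u) :* w)) refl _ _ _ ⟩
    - ((- ι k * a (p ∸ k)) * a k)   ≈⟨ -‿cong (*-congʳ (*-congʳ (ι-∸ k (ℕₚ.<⇒≤ k<p)))) ⟨
    - ((ι (p ∸ k) * a (p ∸ k)) * a k) ≈⟨ -‿cong (*-congʳ (a-inverse (p ∸ k) (ℕₚ.m<n⇒0<n∸m k<p) (ℕₚ.∸-monoʳ-< 0<k (ℕₚ.<⇒≤ k<p)))) ⟩
    - (1# * a k)                    ≈⟨ -‿cong (*-identityˡ _) ⟩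
    - a k ∎

  -- The harmonic number H_(m-1).
  h : ℕ → Carrier
  h m = Σ< m a

  h1≈0 : h 1 ≈ 0#
  h1≈0 = trans (+-identityˡ _) a0≈0

  hp≈0 : h p ≈ 0#
  hp≈0 = double-cancel (begin
    h p + h p                    ≈⟨ +-congˡ (Σ-reflect p a0≈0 (trans (-‿cong a0≈0) (solve 0 (:- con (+ 0) := con (+ 0)) refl)) a-reflect) ⟩
    h p + Σ< p (λ k → - a k)     ≈⟨ +-congˡ (Σ-neg p a) ⟩
    h p - h p                    ≈⟨ -‿inverseʳ _ ⟩
    0# ∎)

  -- In harmonic numbers: H_(p-1-d) = H_d. As H_(p-1) = 0, the left side is minus the sum of the
  -- last d reciprocals, and these are the negatives of the first d.
  h-reflect : ∀ d → d < p → h (p ∸ d) ≈ h (suc d)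
  h-reflect zero    _   = trans hp≈0 (sym h1≈0)
  h-reflect (suc d) d<p = begin
    h (p ∸ suc d)                                       ≈⟨ solve 2 (λ u v → u := (u :+ v) :- v) refl _ _ ⟩
    h (suc (p ∸ suc d)) - a (p ∸ suc d)                 ≈⟨ +-cong (reflexive (≡.cong h (≡.sym (ℕₚ.+-∸-assoc 1 (ℕₚ.<⇒≤ d<p))))) (-‿cong (a-reflect (suc d) (s≤s z≤n) d<p)) ⟩
    h (p ∸ d) - (- a (suc d))                           ≈⟨ +-congʳ (h-reflect d (ℕₚ.<-trans (ℕₚ.n<1+n d) d<p)) ⟩
    h (suc d) - (- a (suc d))                           ≈⟨ solve 2 (λ u v → u :- (:- v) := u :+ v) refl _ _ ⟩
    h (suc (suc d)) ∎

  -- Binomial coefficients modulo p and Fermat's little theorem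

  pCk≈0 : ∀ k → 0 < k → k < p → ι (p C k) ≈ 0#
  pCk≈0 (suc k) 0<k k<p = ι-cancel (suc k) 0<k k<p (begin
    ι (suc k) * ι (p C suc k)     ≈⟨ *-homo (+ suc k) (+ (p C suc k)) ⟨
    φ (+ suc k ℤ.* + (p C suc k)) ≈⟨ reflexive (≡.cong φ (≡.sym (ℤₚ.pos-* (suc k) _))) ⟩
    ι (suc k ℕ.* (p C suc k))     ≈⟨ reflexive (≡.cong ι ([1+k]*[1+n]C[1+k]≡[1+n]*nCk n k)) ⟩
    ι (p ℕ.* (n C k))             ≈⟨ trans (reflexive (≡.cong φ (ℤₚ.pos-* p (n C k)))) (*-homo (+ p) (+ (n C k))) ⟩
    ι p * ι (n C k)               ≈⟨ trans (*-congʳ p≈0) (zeroˡ _) ⟩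
    0# ∎)

  nCk≈±1 : ∀ k → k < p → ι (n C k) ≈ -1# ^ k
  nCk≈±1 zero    _     = 1-homo
  nCk≈±1 (suc k) 1+k<p = begin
    ι (n C suc k)                           ≈⟨ solve 2 (λ u v → v := (u :+ v) :- u) refl (ι (n C k)) _ ⟩
    (ι (n C k) + ι (n C suc k)) - ι (n C k) ≈⟨ +-cong (trans (sym (+-homo _ _)) (trans (reflexive (≡.cong ι (nCk+nC[k+1]≡[n+1]C[k+1] n k))) (pCk≈0 (suc k) (s≤s z≤n) 1+k<p)))
                                                (-‿cong (nCk≈±1 k (ℕₚ.<-trans (ℕₚ.n<1+n k) 1+k<p))) ⟩
    0# - -1# ^ k                            ≈⟨ solve 1 (λ u → con (+ 0) :- u := (:- :1) :* u) refl _ ⟩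
    -1# ^ suc k ∎

  -- Through this, alternating sums over the residues become binomial transforms of order p - 1:
  -- `B-integrate` can then act on `Li₂`, and Wilson's theorem can be read off from a finite
  -- difference.
  B[p-1] : ∀ b → B 1# n b ≈ Σ< p (λ k → -1# ^ k * b k)
  B[p-1] b = trans (B-binomial n b) (Σ-cong p λ k k<p → *-congʳ (nCk≈±1 k k<p))

  B[p] : ∀ b → B 1# p b ≈ b 0 + b p
  B[p] b = begin
    B 1# p b
      ≈⟨ B-binomial p b ⟩
    Σ< p (λ k → ι (p C k) * b k) + ι (p C p) * b p
      ≈⟨ +-cong (Σ-head n _) (*-congʳ (trans (reflexive (≡.cong ι (nCn≡1 p))) 1-homo)) ⟩
    (ι (p C 0) * b 0 + Σ< n (λ k → ι (p C suc k) * b (suc k))) + 1# * b p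
      ≈⟨ +-congʳ (+-cong (*-congʳ 1-homo) (Σ-zero n λ k k<n → trans (*-congʳ (pCk≈0 (suc k) (s≤s z≤n) (s≤s k<n))) (zeroˡ _))) ⟩
    (1# * b 0 + 0#) + 1# * b p
      ≈⟨ solve 2 (λ u v → (:1 :* u :+ con (+ 0)) :+ :1 :* v := u :+ v) refl _ _ ⟩
    b 0 + b p ∎

  [x+1]^p : ∀ x → (x + 1#) ^ p ≈ x ^ p + 1#
  [x+1]^p x = trans (sym (B-pow 1# p x)) (trans (B[p] (x ^_)) (+-comm _ _))

  ι^p : ∀ k → ι k ^ p ≈ ι k
  ι^p zero    = trans (^-congˡ p 0-homo) (trans (0^1+n≈0 n) (sym 0-homo))
  ι^p (suc k) = begin
    ι (suc k) ^ p    ≈⟨ ^-congˡ p (trans (ι-suc k) (+-comm _ _)) ⟩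
    (ι k + 1#) ^ p   ≈⟨ [x+1]^p (ι k) ⟩
    ι k ^ p + 1#     ≈⟨ +-congʳ (ι^p k) ⟩
    ι k + 1#         ≈⟨ trans (+-comm _ _) (sym (ι-suc k)) ⟩
    ι (suc k) ∎

  fermat : ∀ k → 0 < k → k < p → ι k ^ n ≈ 1#
  fermat k 0<k k<p = begin
    ι k ^ n                    ≈⟨ *-identityˡ _ ⟨
    1# * ι k ^ n               ≈⟨ *-congʳ (trans (sym (a-inverse k 0<k k<p)) (*-comm _ _)) ⟩
    (a k * ι k) * ι k ^ n      ≈⟨ *-assoc _ _ _ ⟩
    a k * ι k ^ p              ≈⟨ *-congˡ (ι^p k) ⟩
    a k * ι k                  ≈⟨ trans (*-comm _ _) (a-inverse k 0<k k<p) ⟩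
    1# ∎

  -- Integration: c plays the role of the derivative of b (see B-index).
  B-integrate : ∀ {b c} → b 0 ≈ 0# → (∀ j → j < p → ι j * b j ≈ c j) →
                ∀ m → m < p → B 1# m b ≈ Σ< (suc m) (λ j → a j * B 1# j c)
  B-integrate {b} {c} b0 eq zero    _     = trans b0 (sym (trans (+-identityˡ _) (trans (*-congʳ a0≈0) (zeroˡ _))))
  B-integrate {b} {c} b0 eq (suc m) 1+m<p = begin
    B 1# m (λ k → b (suc k) + 1# * b k)
      -- Raising the order by one adds the transform of `b ∘ suc`, which by `B-index` is the
      -- transform of the derivative divided by m + 1.
      ≈⟨ trans (B-+ 1# m _ _) (trans (+-congˡ (B-cong 1# m λ k _ → *-identityˡ _)) (+-comm _ _)) ⟩
    B 1# m b + B 1# m (b ∘ suc)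
      ≈⟨ +-cong (B-integrate b0 eq m (ℕₚ.<-trans (ℕₚ.n<1+n m) 1+m<p)) (trans (sym (*-identityˡ _)) (*-congʳ (trans (sym (a-inverse (suc m) (s≤s z≤n) 1+m<p)) (*-comm _ _)))) ⟩
    Σ< (suc m) _ + (a (suc m) * ι (suc m)) * B 1# m (b ∘ suc)
      ≈⟨ +-congˡ (trans (*-assoc _ _ _) (*-congˡ (trans (sym (B-index 1# m b)) (B-cong 1# (suc m) λ j j≤ → eq j (ℕₚ.≤-<-trans j≤ 1+m<p))))) ⟩
    Σ< (suc (suc m)) (λ j → a j * B 1# j c) ∎

  -- Li₁ and Li₂ are £₁ and £₂; the term k = 0 vanishes as a 0 = 0.
  Li₁ Li₂ G : Carrier → Carrier
  Li₁ x = Σ< p (λ k → a k * x ^ k)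
  Li₂ x = Σ< p (λ k → (a k * a k) * x ^ k)
  G   x = Σ< p (λ k → (h k * a k) * x ^ k)

  Σ-by-parts : ∀ m g → Σ< m (λ k → a k * Σ< (suc k) g) + Σ< m (λ k → h k * g k) ≈ h m * Σ< m g
  Σ-by-parts zero    g = solve 0 (con (+ 0) :+ con (+ 0) := con (+ 0) :* con (+ 0)) refl
  Σ-by-parts (suc m) g = begin
    (Σ< m (λ k → a k * Σ< (suc k) g) + a m * (Σ< m g + g m)) + (Σ< m (λ k → h k * g k) + h m * g m)
      ≈⟨ solve 6 (λ s t a h G g → (s :+ a :* (G :+ g)) :+ (t :+ h :* g) := (s :+ t) :+ (a :* G :+ (h :+ a) :* g)) refl _ _ _ _ _ _ ⟩
    (Σ< m (λ k → a k * Σ< (suc k) g) + Σ< m (λ k → h k * g k)) + (a m * Σ< m g + (h m + a m) * g m)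
      ≈⟨ +-congʳ (Σ-by-parts m g) ⟩
    h m * Σ< m g + (a m * Σ< m g + (h m + a m) * g m)
      ≈⟨ solve 4 (λ a h G g → h :* G :+ (a :* G :+ (h :+ a) :* g) := (h :+ a) :* (G :+ g)) refl _ _ _ _ ⟩
    (h m + a m) * (Σ< m g + g m) ∎

  Li₂-expand : ∀ x → Li₂ x ≈ - (G (1# - x) - G 1#)
  Li₂-expand x = begin
    Li₂ x
      ≈⟨ Σ-cong p (λ k _ → trans (*-congˡ (x^k k)) (solve 3 (λ a s z → (a :* a) :* (s :* z) := s :* (a :* (a :* z))) refl _ _ _)) ⟩
    Σ< p (λ k → -1# ^ k * b₂ k)
      ≈⟨ B[p-1] b₂ ⟨
    B 1# n b₂
      ≈⟨ B-integrate b₂0 deriv₂ n ℕₚ.≤-refl ⟩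
    Σ< p (λ k → a k * B 1# k b₁)
      ≈⟨ Σ-cong p (λ k k<p → *-congˡ (trans (B-integrate b₁0 deriv₁ k k<p) (Σ-cong (suc k) λ j _ → *-congˡ (B-c j)))) ⟩
    Σ< p (λ k → a k * Σ< (suc k) g)
      ≈⟨ solve 2 (λ u v → u := (u :+ v) :- v) refl _ _ ⟩
    (Σ< p (λ k → a k * Σ< (suc k) g) + Σ< p (λ k → h k * g k)) - Σ< p (λ k → h k * g k)
      ≈⟨ +-congʳ (trans (Σ-by-parts p g) (trans (*-congʳ hp≈0) (zeroˡ _))) ⟩
    0# - Σ< p (λ k → h k * g k)
      ≈⟨ trans (+-identityˡ _) (-‿cong (trans (Σ-cong p λ k _ →
           trans (*-congˡ (*-congˡ (+-congˡ (-‿cong (sym (1^n≈1 k))))))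
                 (solve 4 (λ h a y o → h :* (a :* (y :- o)) := (h :* a) :* y :+ :- ((h :* a) :* o)) refl _ _ _ _))
           (trans (Σ-+ p _ _) (+-congˡ (Σ-neg p _))))) ⟩
    - (G y - G 1#) ∎
    where
    z = - x
    y = 1# - x
    b₁ b₂ c g : ℕ → Carrier
    b₁ k = a k * z ^ k
    b₂ k = a k * (a k * z ^ k)
    c k = z ^ k + - (0# ^ k)
    g k = a k * (y ^ k - 1#)
    x^k : ∀ k → x ^ k ≈ -1# ^ k * z ^ k
    x^k k = trans (^-congˡ k (solve 1 (λ x → x := (:- :1) :* (:- x)) refl x)) (^-distrib-* -1# z k)
    b₁0 : b₁ 0 ≈ 0#
    b₁0 = trans (*-congʳ a0≈0) (zeroˡ _)
    b₂0 : b₂ 0 ≈ 0#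
    b₂0 = trans (*-congʳ a0≈0) (zeroˡ _)
    deriv₁ : ∀ j → j < p → ι j * b₁ j ≈ c j
    deriv₁ zero    _     = trans (*-congʳ 0-homo) (solve 1 (λ u → con (+ 0) :* u := :1 :- :1) refl _)
    deriv₁ (suc j) 1+j<p = begin
      ι (suc j) * (a (suc j) * z ^ suc j) ≈⟨ trans (sym (*-assoc _ _ _)) (*-congʳ (a-inverse (suc j) (s≤s z≤n) 1+j<p)) ⟩
      1# * z ^ suc j                      ≈⟨ solve 1 (λ u → :1 :* u := u :+ :- con (+ 0)) refl _ ⟩
      z ^ suc j - 0#                      ≈⟨ +-congˡ (-‿cong (0^1+n≈0 j)) ⟨
      z ^ suc j - 0# ^ suc j ∎
    deriv₂ : ∀ j → j < p → ι j * b₂ j ≈ b₁ j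
    deriv₂ zero    _     = trans (*-congˡ b₂0) (trans (zeroʳ _) (sym b₁0))
    deriv₂ (suc j) 1+j<p = trans (sym (*-assoc _ _ _)) (trans (*-congʳ (a-inverse (suc j) (s≤s z≤n) 1+j<p)) (*-identityˡ _))
    B-c : ∀ j → B 1# j c ≈ y ^ j - 1#
    B-c j = trans (B-+ 1# j _ _) (+-cong (trans (B-pow 1# j z) (^-congˡ j (+-comm _ _)))
      (trans (B-cong 1# j λ k _ → solve 1 (λ u → :- u := (:- :1) :* u) refl (0# ^ k))
      (trans (B-* 1# j -1# _) (trans (*-congˡ (trans (B-pow 1# j 0#) (trans (^-congˡ j (+-identityˡ _)) (1^n≈1 j)))) (*-identityʳ _)))))

  h² : ∀ m → h m * h m ≈ (Σ< m (λ k → h k * a k) + Σ< m (λ k → h k * a k)) + Σ< m (λ k → a k * a k)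
  h² zero    = solve 0 (con (+ 0) :* con (+ 0) := (con (+ 0) :+ con (+ 0)) :+ con (+ 0)) refl
  h² (suc m) = begin
    (h m + a m) * (h m + a m)
      ≈⟨ solve 2 (λ h a → (h :+ a) :* (h :+ a) := h :* h :+ ((h :* a :+ h :* a) :+ a :* a)) refl _ _ ⟩
    h m * h m + ((h m * a m + h m * a m) + a m * a m)
      ≈⟨ +-congʳ (h² m) ⟩
    ((s + s) + t) + ((h m * a m + h m * a m) + a m * a m)
      ≈⟨ solve 4 (λ s t x y → ((s :+ s) :+ t) :+ ((x :+ x) :+ y) := ((s :+ x) :+ (s :+ x)) :+ (t :+ y)) refl _ _ _ _ ⟩
    ((s + h m * a m) + (s + h m * a m)) + (t + a m * a m) ∎
    where
    s = Σ< m (λ k → h k * a k)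
    t = Σ< m (λ k → a k * a k)

  G0≈0 : G 0# ≈ 0#
  G0≈0 = Σ-zero p λ where
    zero    _ → solve 1 (λ a → (con (+ 0) :* a) :* :1 := con (+ 0)) refl _
    (suc k) _ → trans (*-congˡ (0^1+n≈0 k)) (zeroʳ _)

  -- Li₂ 1 = G 1 by Li₂-expand, while h² at p gives 2 G 1 + Li₂ 1 = 0.
  G1≈0 : G 1# ≈ 0#
  G1≈0 = ι-cancel 3 (s≤s z≤n) (s≤s 3≤n) (begin
    ι 3 * G 1#                ≈⟨ *-congʳ ι3≈1+1+1 ⟩
    (1# + (1# + 1#)) * G 1#   ≈⟨ solve 1 (λ g → (:1 :+ (:1 :+ :1)) :* g := (g :+ g) :+ g) refl _ ⟩
    (G 1# + G 1#) + G 1#      ≈⟨ +-congˡ Li₂1≈G1 ⟨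
    (G 1# + G 1#) + Li₂ 1#    ≈⟨ +-cong (+-cong (drop1 _) (drop1 _)) (drop1 _) ⟩
    (Σ< p (λ k → h k * a k) + Σ< p (λ k → h k * a k)) + Σ< p (λ k → a k * a k) ≈⟨ h² p ⟨
    h p * h p                 ≈⟨ trans (*-congʳ hp≈0) (zeroˡ _) ⟩
    0# ∎)
    where
    drop1 : ∀ (f : ℕ → Carrier) → Σ< p (λ k → f k * 1# ^ k) ≈ Σ< p f
    drop1 f = Σ-cong p λ k _ → trans (*-congˡ (1^n≈1 k)) (*-identityʳ _)
    G-cong : ∀ {x y} → x ≈ y → G x ≈ G y
    G-cong eq = Σ-cong p λ k _ → *-congˡ (^-congˡ k eq)
    Li₂1≈G1 : Li₂ 1# ≈ G 1#
    Li₂1≈G1 = begin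
      Li₂ 1#                    ≈⟨ Li₂-expand 1# ⟩
      - (G (1# - 1#) - G 1#)    ≈⟨ -‿cong (+-congʳ (trans (G-cong (-‿inverseʳ 1#)) G0≈0)) ⟩
      - (0# - G 1#)             ≈⟨ solve 1 (λ g → :- (con (+ 0) :- g) := g) refl _ ⟩
      G 1# ∎

  Σa²≈0 : Σ< p (λ k → a k * a k) ≈ 0#
  Σa²≈0 = begin
    A                       ≈⟨ solve 2 (λ s t → t := ((s :+ s) :+ t) :- (s :+ s)) refl _ _ ⟩
    ((s + s) + A) - (s + s) ≈⟨ +-cong (trans (sym (h² p)) (trans (*-congʳ hp≈0) (zeroˡ _))) (-‿cong (+-cong s≈0 s≈0)) ⟩
    0# - (0# + 0#)          ≈⟨ solve 0 (con (+ 0) :- (con (+ 0) :+ con (+ 0)) := con (+ 0)) refl ⟩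
    0# ∎
    where
    s = Σ< p (λ k → h k * a k)
    A = Σ< p (λ k → a k * a k)
    s≈0 : s ≈ 0#
    s≈0 = trans (Σ-cong p λ k _ → sym (trans (*-congˡ (1^n≈1 k)) (*-identityʳ _))) G1≈0

  Li₂≈-G : ∀ x → Li₂ x ≈ - G (1# - x)
  Li₂≈-G x = trans (Li₂-expand x) (-‿cong (trans (+-congˡ (-‿cong G1≈0)) (solve 1 (λ g → g :- con (+ 0) := g) refl _)))

  -- The product of £₁ at reciprocal arguments and Granville's congruence

  partial-fractions : ∀ j k → 0 < j → 0 < k → j ℕ.+ k < p → a (k ℕ.+ j) * a j ≈ a k * (a j - a (k ℕ.+ j))
  partial-fractions j k 0<j 0<k j+k<p = begin
    am * aj
      ≈⟨ *-identityˡ _ ⟨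
    1# * (am * aj)
      ≈⟨ *-congʳ (trans (sym (a-inverse k 0<k (ℕₚ.≤-<-trans (ℕₚ.m≤n+m k j) j+k<p))) (*-comm _ _)) ⟩
    (a k * ι k) * (am * aj)
      ≈⟨ solve 5 (λ a i j m n → (a :* i) :* (m :* n) := a :* (n :* ((i :+ j) :* m) :- m :* (j :* n))) refl (a k) (ι k) (ι j) am aj ⟩
    a k * (aj * ((ι k + ι j) * am) - am * (ι j * aj))
      ≈⟨ *-congˡ (+-cong (*-congˡ (trans (*-congʳ (sym (+-homo (+ k) (+ j)))) (a-inverse (k ℕ.+ j) (ℕₚ.≤-trans 0<k (ℕₚ.m≤m+n k j)) (≡.subst (_< p) (ℕₚ.+-comm j k) j+k<p))))
                         (-‿cong (*-congˡ (a-inverse j 0<j (ℕₚ.≤-<-trans (ℕₚ.m≤m+n j k) j+k<p))))) ⟩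
    a k * (aj * 1# - am * 1#)
      ≈⟨ solve 3 (λ a m n → a :* (n :* :1 :- m :* :1) := a :* (n :- m)) refl _ _ _ ⟩
    a k * (aj - am) ∎
    where
    aj = a j
    am = a (k ℕ.+ j)

  -- This is `G` with H_k in place of H_(k-1). The substitution k ↦ p - k exchanges the two, up to
  -- sign and a factor x^p.
  J : Carrier → Carrier
  J x = Σ< p (λ k → (a k * h (suc k)) * x ^ k)

  J≈G+Li₂ : ∀ x → J x ≈ G x + Li₂ x
  J≈G+Li₂ x = trans (Σ-cong p λ k _ → solve 3 (λ a h x → (a :* (h :+ a)) :* x := (h :* a) :* x :+ (a :* a) :* x) refl (a k) (h k) (x ^ k))
                    (Σ-+ p _ _)

  module Reciprocal (x y : Carrier) (xy≈1 : x * y ≈ 1#) where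

    x^k*y^k≈1 : ∀ k → x ^ k * y ^ k ≈ 1#
    x^k*y^k≈1 k = trans (sym (^-distrib-* x y k)) (trans (^-congˡ k xy≈1) (1^n≈1 k))

    x^m*y^[m∸k]≈x^k : ∀ m k → k ≤ m → x ^ m * y ^ (m ∸ k) ≈ x ^ k
    x^m*y^[m∸k]≈x^k m k k≤m = begin
      x ^ m * y ^ j          ≈⟨ *-congʳ (trans (reflexive (≡.cong (x ^_) (≡.sym (ℕₚ.m+[n∸m]≡n k≤m)))) (^-homo-* x k j)) ⟩
      (x ^ k * x ^ j) * y ^ j ≈⟨ trans (*-assoc _ _ _) (*-congˡ (x^k*y^k≈1 j)) ⟩
      x ^ k * 1#              ≈⟨ *-identityʳ _ ⟩
      x ^ k ∎
      where j = m ∸ k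

    -- The off-diagonal terms with larger exponent m, indexed by the difference d of the two
    -- exponents: with y = 1/x only x^d remains of the powers.
    cross-terms : ∀ m → m < p → (a m * x ^ m) * Σ< m (λ k → a k * y ^ k) ≈ Σ< m (λ d → a d * (a (m ∸ d) - a m) * x ^ d)
    cross-terms m m<p = trans (sym (Σ-* m _ _)) (Σ-reflect m
        (trans (*-congˡ (trans (*-congʳ a0≈0) (zeroˡ _))) (zeroʳ _))
        (trans (*-congʳ (trans (*-congʳ a0≈0) (zeroˡ _))) (zeroˡ _))
        λ k 0<k k<m → begin
          (a m * x ^ m) * (a (m ∸ k) * y ^ (m ∸ k))
            ≈⟨ solve 4 (λ a b c d → (a :* b) :* (c :* d) := (a :* c) :* (b :* d)) refl _ _ _ _ ⟩
          (a m * a (m ∸ k)) * (x ^ m * y ^ (m ∸ k))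
            ≈⟨ *-cong (≡.subst (λ i → a i * a (m ∸ k) ≈ a k * (a (m ∸ k) - a i)) (ℕₚ.m+[n∸m]≡n (ℕₚ.<⇒≤ k<m))
                 (partial-fractions (m ∸ k) k (ℕₚ.m<n⇒0<n∸m k<m) 0<k (≡.subst (_< p) (≡.sym (ℕₚ.m∸n+n≡m (ℕₚ.<⇒≤ k<m))) m<p)))
                 (x^m*y^[m∸k]≈x^k m k (ℕₚ.<⇒≤ k<m)) ⟩
          (a k * (a (m ∸ k) - a m)) * x ^ k ∎)

    -- The substitution k ↦ p - k in Li₁, J and Li₂.
    x^p*Li₁[y] : x ^ p * Li₁ y ≈ - Li₁ x
    x^p*Li₁[y] = trans (sym (Σ-* p _ _)) (trans (Σ-reflect p
      (trans (*-congˡ (trans (*-congʳ a0≈0) (zeroˡ _))) (zeroʳ _))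
      (trans (-‿cong (trans (*-congʳ a0≈0) (zeroˡ _))) (solve 0 (:- con (+ 0) := con (+ 0)) refl))
      λ k 0<k k<p → begin
        x ^ p * (a (p ∸ k) * y ^ (p ∸ k))   ≈⟨ solve 3 (λ x a y → x :* (a :* y) := a :* (x :* y)) refl _ _ _ ⟩
        a (p ∸ k) * (x ^ p * y ^ (p ∸ k))   ≈⟨ *-cong (a-reflect k 0<k k<p) (x^m*y^[m∸k]≈x^k p k (ℕₚ.<⇒≤ k<p)) ⟩
        - a k * x ^ k                       ≈⟨ solve 2 (λ a x → (:- a) :* x := :- (a :* x)) refl _ _ ⟩
        - (a k * x ^ k) ∎) (Σ-neg p _))

    x^p*J[y] : x ^ p * J y ≈ - G x
    x^p*J[y] = trans (sym (Σ-* p _ _)) (trans (Σ-reflect p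
      (trans (*-congˡ (trans (*-congʳ (trans (*-congʳ a0≈0) (zeroˡ _))) (zeroˡ _))) (zeroʳ _))
      (solve 2 (λ a x → :- ((con (+ 0) :* a) :* x) := con (+ 0)) refl _ _)
      reindex) (Σ-neg p _))
      where
      reindex : ∀ k → 0 < k → k < p → x ^ p * ((a (p ∸ k) * h (suc (p ∸ k))) * y ^ (p ∸ k)) ≈ - ((h k * a k) * x ^ k)
      reindex (suc k) 0<k k<p = begin
        x ^ p * ((a (p ∸ suc k) * h (suc (p ∸ suc k))) * y ^ (p ∸ suc k))
          ≈⟨ solve 4 (λ x a h y → x :* ((a :* h) :* y) := (a :* h) :* (x :* y)) refl _ _ _ _ ⟩
        (a (p ∸ suc k) * h (suc (p ∸ suc k))) * (x ^ p * y ^ (p ∸ suc k))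
          -- For the index K = k + 1 this is H_(p-K) = H_(K-1), the reason why `J` becomes `G`.
          ≈⟨ *-cong (*-cong (a-reflect (suc k) 0<k k<p)
               (trans (reflexive (≡.cong h (≡.sym (ℕₚ.+-∸-assoc 1 (ℕₚ.<⇒≤ k<p))))) (h-reflect k (ℕₚ.<-trans (ℕₚ.n<1+n k) k<p))))
               (x^m*y^[m∸k]≈x^k p (suc k) (ℕₚ.<⇒≤ k<p)) ⟩
        (- a (suc k) * h (suc k)) * x ^ suc k
          ≈⟨ solve 3 (λ a h x → ((:- a) :* h) :* x := :- ((h :* a) :* x)) refl _ _ _ ⟩
        - ((h (suc k) * a (suc k)) * x ^ suc k) ∎

    x^p*Li₂[y] : x ^ p * Li₂ y ≈ Li₂ x
    x^p*Li₂[y] = trans (sym (Σ-* p _ _)) (Σ-reflect p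
      (trans (*-congˡ (trans (*-congʳ (trans (*-congʳ a0≈0) (zeroˡ _))) (zeroˡ _))) (zeroʳ _))
      (trans (*-congʳ (trans (*-congʳ a0≈0) (zeroˡ _))) (zeroˡ _))
      λ k 0<k k<p → begin
        x ^ p * ((a (p ∸ k) * a (p ∸ k)) * y ^ (p ∸ k))
          ≈⟨ solve 3 (λ x a y → x :* ((a :* a) :* y) := (a :* a) :* (x :* y)) refl _ _ _ ⟩
        (a (p ∸ k) * a (p ∸ k)) * (x ^ p * y ^ (p ∸ k))
          ≈⟨ *-cong (*-cong (a-reflect k 0<k k<p) (a-reflect k 0<k k<p)) (x^m*y^[m∸k]≈x^k p k (ℕₚ.<⇒≤ k<p)) ⟩
        (- a k * - a k) * x ^ k
          ≈⟨ *-congʳ (solve 1 (λ a → (:- a) :* (:- a) := a :* a) refl _) ⟩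
        (a k * a k) * x ^ k ∎)

  module _ (x y : Carrier) (xy≈1 : x * y ≈ 1#) where
    open Reciprocal x y xy≈1
    private module Swapped = Reciprocal y x (trans (*-comm y x) xy≈1)

    -- The coefficient of x^d + y^d is the sum of 1/(j (j + d)) over 0 < j < m - d. By partial
    -- fractions it is (H_(m-1-d) - H_(m-1) + H_d) / d. The diagonal is the separate sum of squares;
    -- d = 0 contributes nothing because `a 0` is 0.
    Li₁*Li₁-truncated : ∀ m → m ≤ p →
      Σ< m (λ k → a k * x ^ k) * Σ< m (λ k → a k * y ^ k) ≈
      Σ< m (λ k → a k * a k) + Σ< m (λ d → (a d * (x ^ d + y ^ d)) * ((h (m ∸ d) - h m) + h (suc d)))
    Li₁*Li₁-truncated zero    _   = solve 0 (con (+ 0) :* con (+ 0) := con (+ 0) :+ con (+ 0)) refl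
    Li₁*Li₁-truncated (suc m) m<p = begin
      (X + a m * x ^ m) * (Y + a m * y ^ m)
        ≈⟨ solve 5 (λ X Y a x y → (X :+ a :* x) :* (Y :+ a :* y) := X :* Y :+ ((((a :* x) :* Y) :+ ((a :* y) :* X)) :+ (a :* a) :* (x :* y))) refl _ _ _ _ _ ⟩
      X * Y + (((a m * x ^ m) * Y + (a m * y ^ m) * X) + (a m * a m) * (x ^ m * y ^ m))
        ≈⟨ +-cong (Li₁*Li₁-truncated m (ℕₚ.<⇒≤ m<p)) (+-cong (+-cong (cross-terms m m<p) (Swapped.cross-terms m m<p))
             (trans (*-congˡ (x^k*y^k≈1 m)) (*-identityʳ _))) ⟩
      (A + S) + ((Σ< m (λ d → a d * (a (m ∸ d) - a m) * x ^ d) + Σ< m (λ d → a d * (a (m ∸ d) - a m) * y ^ d)) + a m * a m)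
        ≈⟨ solve 5 (λ A S C D q → (A :+ S) :+ ((C :+ D) :+ q) := (A :+ q) :+ (S :+ (C :+ D))) refl _ _ _ _ _ ⟩
      (A + a m * a m) + (S + (Σ< m (λ d → a d * (a (m ∸ d) - a m) * x ^ d) + Σ< m (λ d → a d * (a (m ∸ d) - a m) * y ^ d)))
        ≈⟨ +-congˡ (trans (+-congˡ (sym (Σ-+ m _ _))) (trans (sym (Σ-+ m _ _)) (Σ-cong m λ d d<m → step d d<m))) ⟩
      (A + a m * a m) + Σ< m (λ d → (a d * (x ^ d + y ^ d)) * ((h (suc m ∸ d) - h (suc m)) + h (suc d)))
        -- The new summand d = m is zero: its bracket reduces to `h 1`, that is H_0.
        ≈⟨ +-congˡ (trans (sym (+-identityʳ _)) (+-congˡ (sym last))) ⟩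
      (A + a m * a m) + Σ< (suc m) (λ d → (a d * (x ^ d + y ^ d)) * ((h (suc m ∸ d) - h (suc m)) + h (suc d))) ∎
      where
      X = Σ< m (λ k → a k * x ^ k)
      Y = Σ< m (λ k → a k * y ^ k)
      A = Σ< m (λ k → a k * a k)
      S = Σ< m (λ d → (a d * (x ^ d + y ^ d)) * ((h (m ∸ d) - h m) + h (suc d)))
      step : ∀ d → d < m →
        (a d * (x ^ d + y ^ d)) * ((h (m ∸ d) - h m) + h (suc d)) + (a d * (a (m ∸ d) - a m) * x ^ d + a d * (a (m ∸ d) - a m) * y ^ d)
        ≈ (a d * (x ^ d + y ^ d)) * ((h (suc m ∸ d) - h (suc m)) + h (suc d))
      step d d<m = trans
        (solve 8 (λ a x y h₁ h₂ h₃ b c → (a :* (x :+ y)) :* ((h₁ :- h₂) :+ h₃) :+ (a :* (b :- c) :* x :+ a :* (b :- c) :* y)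
                    := (a :* (x :+ y)) :* (((h₁ :+ b) :- (h₂ :+ c)) :+ h₃)) refl (a d) (x ^ d) (y ^ d) (h (m ∸ d)) (h m) (h (suc d)) (a (m ∸ d)) (a m))
        (reflexive (≡.cong (λ i → (a d * (x ^ d + y ^ d)) * ((h i - h (suc m)) + h (suc d))) (≡.sym (ℕₚ.+-∸-assoc 1 (ℕₚ.<⇒≤ d<m)))))
      last : (a m * (x ^ m + y ^ m)) * ((h (suc m ∸ m) - h (suc m)) + h (suc m)) ≈ 0#
      last = trans (*-congˡ (trans (solve 2 (λ u v → (u :- v) :+ v := u) refl _ _) (trans (reflexive (≡.cong h (ℕₚ.m+n∸n≡m 1 m))) h1≈0))) (zeroʳ _)

    Li₁*Li₁ : Li₁ x * Li₁ y ≈ (J x + J y) + (J x + J y)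
    Li₁*Li₁ = begin
      Li₁ x * Li₁ y
        ≈⟨ Li₁*Li₁-truncated p ℕₚ.≤-refl ⟩
      Σ< p (λ k → a k * a k) + Σ< p (λ d → (a d * (x ^ d + y ^ d)) * ((h (p ∸ d) - h p) + h (suc d)))
        -- At full length each bracket becomes 2 H_d, by reflection and H_(p-1) = 0.
        ≈⟨ +-cong Σa²≈0 (Σ-cong p λ d d<p → trans (*-congˡ (+-congʳ (+-cong (h-reflect d d<p) (-‿cong hp≈0))))
             (solve 4 (λ a x y h → (a :* (x :+ y)) :* ((h :- con (+ 0)) :+ h) := ((a :* h) :* x :+ (a :* h) :* y) :+ ((a :* h) :* x :+ (a :* h) :* y)) refl _ _ _ _)) ⟩
      0# + Σ< p (λ d → ((a d * h (suc d)) * x ^ d + (a d * h (suc d)) * y ^ d) + ((a d * h (suc d)) * x ^ d + (a d * h (suc d)) * y ^ d))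
        ≈⟨ trans (+-identityˡ _) (trans (Σ-+ p _ _) (+-cong (Σ-+ p _ _) (Σ-+ p _ _))) ⟩
      (J x + J y) + (J x + J y) ∎

    -- Granville's congruence for the square of the Fermat quotient Li₁.
    Li₁² : Li₁ x * Li₁ x ≈ - (1# + 1#) * ((1# - x ^ p) * Li₂ (1# - x) + x ^ p * Li₂ x)
    Li₁² = begin
      Li₁ x * Li₁ x
        ≈⟨ solve 1 (λ l → l :* l := :- (l :* (:- l))) refl _ ⟩
      - (Li₁ x * - Li₁ x)
        ≈⟨ -‿cong (*-congˡ x^p*Li₁[y]) ⟨
      - (Li₁ x * (x ^ p * Li₁ y))
        ≈⟨ -‿cong (solve 3 (λ l m q → l :* (q :* m) := q :* (l :* m)) refl _ _ _) ⟩
      - (x ^ p * (Li₁ x * Li₁ y))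
        ≈⟨ -‿cong (*-congˡ Li₁*Li₁) ⟩
      - (x ^ p * ((J x + J y) + (J x + J y)))
        ≈⟨ solve 3 (λ q j k → :- (q :* ((j :+ k) :+ (j :+ k))) := :- (:1 :+ :1) :* (q :* j :+ q :* k)) refl _ _ _ ⟩
      - (1# + 1#) * (x ^ p * J x + x ^ p * J y)
        ≈⟨ *-congˡ (+-cong (*-congˡ (J≈G+Li₂ x)) x^p*J[y]) ⟩
      - (1# + 1#) * (x ^ p * (G x + Li₂ x) + - G x)
        ≈⟨ *-congˡ (solve 3 (λ q g l → q :* (g :+ l) :+ :- g := (:1 :- q) :* (:- g) :+ q :* l) refl _ _ _) ⟩
      - (1# + 1#) * ((1# - x ^ p) * - G x + x ^ p * Li₂ x)
        ≈⟨ *-congˡ (+-congʳ (*-congˡ (trans (-‿cong (Σ-cong p λ k _ → *-congˡ (^-congˡ k (solve 1 (λ x → x := :1 :- (:1 :- x)) refl x)))) (sym (Li₂≈-G (1# - x)))))) ⟩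
      - (1# + 1#) * ((1# - x ^ p) * Li₂ (1# - x) + x ^ p * Li₂ x) ∎

  -- Wilson's theorem, £₁ as a Fermat quotient, and the Legendre symbol of -1

  -- Each step moves the factor p - (k + 1) of the second factorial into the first one, as - (k +
  -- 1). Halfway this is (m!)² up to sign.
  n!≈±k!*[n∸k]! : ∀ k → k ≤ n → ι (n !) ≈ -1# ^ k * (ι (k !) * ι ((n ∸ k) !))
  n!≈±k!*[n∸k]! zero    _   = sym (trans (*-identityˡ _) (trans (*-congʳ 1-homo) (*-identityˡ _)))
  n!≈±k!*[n∸k]! (suc k) k<n = begin
    ι (n !)
      ≈⟨ n!≈±k!*[n∸k]! k (ℕₚ.<⇒≤ k<n) ⟩
    -1# ^ k * (ι (k !) * ι ((n ∸ k) !))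
      ≈⟨ *-congˡ (*-congˡ (trans (reflexive (≡.cong (λ i → ι (i !)) n∸k)) (trans (ι-* _ _)
           (*-congʳ (trans (reflexive (≡.cong ι (≡.sym n∸k))) (ι-∸ (suc k) (s≤s (ℕₚ.<⇒≤ k<n)))))))) ⟩
    -1# ^ k * (ι (k !) * (- ι (suc k) * ι ((n ∸ suc k) !)))
      ≈⟨ solve 4 (λ s f i g → s :* (f :* ((:- i) :* g)) := ((:- :1) :* s) :* ((i :* f) :* g)) refl _ _ _ _ ⟩
    -1# ^ suc k * ((ι (suc k) * ι (k !)) * ι ((n ∸ suc k) !))
      ≈⟨ *-congˡ (*-congʳ (ι-* (suc k) (k !))) ⟨
    -1# ^ suc k * (ι (suc k !) * ι ((n ∸ suc k) !)) ∎
    where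
    n∸k : n ∸ k ≡ suc (n ∸ suc k)
    n∸k = ℕₚ.+-∸-assoc 1 k<n

  -- By Fermat the n-th difference of k^n is a sum of n ones.
  wilson : -1# ^ n ≈ 1# → ι (n !) ≈ -1#
  wilson even = begin
    ι (n !)                                           ≈⟨ *-identityˡ _ ⟨
    1# * ι (n !)                                      ≈⟨ *-congʳ even ⟨
    -1# ^ n * ι (n !)                                 ≈⟨ difference-≡ n 0# ⟨
    B 1# n (λ k → (ι k + 0#) ^ n * -1# ^ k)           ≈⟨ B[p-1] _ ⟩
    Σ< p (λ k → -1# ^ k * ((ι k + 0#) ^ n * -1# ^ k)) ≈⟨ Σ-head n _ ⟩
    1# * ((ι 0 + 0#) ^ n * 1#) + Σ< n (λ k → -1# ^ suc k * ((ι (suc k) + 0#) ^ n * -1# ^ suc k))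
      ≈⟨ +-cong (trans (*-identityˡ _) (trans (*-identityʳ _) (trans (^-congˡ n (trans (+-identityʳ _) 0-homo)) (0^n≈0 3≤n))))
                (Σ-cong n λ k k<n → trans (*-congˡ (*-congʳ (trans (^-congˡ n (+-identityʳ _)) (fermat (suc k) (s≤s z≤n) (s≤s k<n)))))
                   (trans (*-congˡ (*-identityˡ _)) (±1*±1≈1 (suc k)))) ⟩
    0# + Σ< n (λ _ → 1#)                              ≈⟨ trans (+-identityˡ _) (Σ-1 n) ⟩
    ι n                                               ≈⟨ solve 1 (λ u → u := (:1 :+ u) :- :1) refl _ ⟩
    (1# + ι n) - 1#                                   ≈⟨ +-congʳ (trans (sym (ι-suc n)) p≈0) ⟩
    0# - 1#                                           ≈⟨ +-identityˡ _ ⟩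
    -1# ∎
    where
    0^n≈0 : ∀ {m} → 3 ≤ m → 0# ^ m ≈ 0#
    0^n≈0 (s≤s _) = zeroˡ _
    Σ-1 : ∀ m → Σ< m (λ _ → 1#) ≈ ι m
    Σ-1 zero    = sym 0-homo
    Σ-1 (suc m) = trans (+-congʳ (Σ-1 m)) (trans (+-comm _ _) (sym (ι-suc m)))

  -- The sum is the one of `p*binomialSum`, reduced modulo p with C(p-1,k) ≡ (-1)^k. So ((x + 1)^p -
  -- 1 - x^p) / p reduces to - £₁(- x).
  binomialSum≈-Li₁ : ∀ x → Σ< n (λ k → ι (n C k) * (a (suc k) * x ^ suc k)) ≈ - Li₁ (- x)
  binomialSum≈-Li₁ x = begin
    Σ< n (λ k → ι (n C k) * (a (suc k) * x ^ suc k))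
      ≈⟨ Σ-cong n (λ k k<n → trans (*-cong (nCk≈±1 k (ℕₚ.m<n⇒m<1+n k<n)) (*-congˡ (trans (^-congˡ (suc k) (solve 1 (λ x → x := (:- :1) :* (:- x)) refl x)) (^-distrib-* -1# (- x) (suc k)))))
           (trans (solve 3 (λ s a y → s :* (a :* ((:- :1 :* s) :* y)) := (s :* s) :* (:- (a :* y))) refl _ _ _) (trans (*-congʳ (±1*±1≈1 k)) (*-identityˡ _)))) ⟩
    Σ< n (λ k → - (a (suc k) * (- x) ^ suc k))
      ≈⟨ Σ-neg n _ ⟩
    - Σ< n (λ k → a (suc k) * (- x) ^ suc k)
      ≈⟨ -‿cong (trans (+-congʳ (trans (*-congʳ a0≈0) (zeroˡ _))) (+-identityˡ _)) ⟨
    - (a 0 * 1# + Σ< n (λ k → a (suc k) * (- x) ^ suc k))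
      ≈⟨ -‿cong (Σ-head n _) ⟨
    - Li₁ (- x) ∎

  Li₁[-x] : ∀ {x w} → Σ< n (λ k → ι (n C k) * (a (suc k) * x ^ suc k)) ≈ w → Li₁ (- x) ≈ - w
  Li₁[-x] eq = trans (solve 1 (λ u → u := :- (:- u)) refl _) (-‿cong (trans (sym (binomialSum≈-Li₁ _)) eq))

  module Legendre (m : ℕ) (n≡m+m : n ≡ m ℕ.+ m) (p∤1 : ¬ p ∣ 1) (p∣-if-≈0 : ∀ z → φ z ≈ 0# → p ∣ ℤ.∣ z ∣) where

    ι≈0-if-p∣ : ∀ k → p ∣ k → ι k ≈ 0#
    ι≈0-if-p∣ k (divides c eq) = trans (reflexive (≡.cong ι eq)) (trans (ι-* c p) (trans (*-congˡ p≈0) (zeroʳ _)))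

    ι[x²+1] : ∀ x → ι (x ℕ.* x ℕ.+ 1) ≈ ι x * ι x + 1#
    ι[x²+1] x = trans (+-homo (+ (x ℕ.* x)) (+ 1)) (+-cong (ι-* x x) 1-homo)

    [-1]^m≈1 : ∀ x → x < p → p ∣ x ℕ.* x ℕ.+ 1 → -1# ^ m ≈ 1#
    [-1]^m≈1 zero    _   p∣1 = contradiction p∣1 p∤1
    [-1]^m≈1 (suc x) x<p p∣  = begin
      -1# ^ m                         ≈⟨ ^-congˡ m (trans (solve 1 (λ u → :- :1 := :- (u :+ :1) :+ u) refl _) (trans (+-congʳ (-‿cong (trans (sym (ι[x²+1] (suc x))) (ι≈0-if-p∣ _ p∣)))) (solve 1 (λ u → :- con (+ 0) :+ u := u) refl _))) ⟩
      (ι (suc x) * ι (suc x)) ^ m     ≈⟨ x^[m+m] _ m ⟨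
      ι (suc x) ^ (m ℕ.+ m)           ≈⟨ reflexive (≡.cong (ι (suc x) ^_) (≡.sym n≡m+m)) ⟩
      ι (suc x) ^ n                   ≈⟨ fermat (suc x) (s≤s z≤n) x<p ⟩
      1# ∎

    [m!]²≈-1 : -1# ^ m ≈ 1# → ι (m !) * ι (m !) ≈ -1#
    [m!]²≈-1 even = begin
      ι (m !) * ι (m !)                        ≈⟨ *-identityˡ _ ⟨
      1# * (ι (m !) * ι (m !))                 ≈⟨ *-cong (sym even) (*-congˡ (reflexive (≡.cong (λ i → ι (i !)) (≡.sym (≡.trans (≡.cong (_∸ m) n≡m+m) (ℕₚ.m+n∸n≡m m m)))))) ⟩
      -1# ^ m * (ι (m !) * ι ((n ∸ m) !))      ≈⟨ n!≈±k!*[n∸k]! m (≡.subst (m ≤_) (≡.sym n≡m+m) (ℕₚ.m≤m+n m m)) ⟨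
      ι (n !)                                  ≈⟨ wilson (trans (reflexive (≡.cong (-1# ^_) n≡m+m)) (-1^[m+m]≈1 m)) ⟩
      -1# ∎

    -- The root is m!, reduced modulo p because `isSquareMod` searches only below p.
    -1-square : -1# ^ m ≈ 1# → Σ ℕ λ x → x < p × p ∣ x ℕ.* x ℕ.+ 1
    -1-square even = x , m%n<n (m !) p , p∣-if-≈0 (+ (x ℕ.* x ℕ.+ 1)) (begin
      ι (x ℕ.* x ℕ.+ 1)          ≈⟨ ι[x²+1] x ⟩
      ι x * ι x + 1#             ≈⟨ +-congʳ (*-cong ιx ιx) ⟩
      ι (m !) * ι (m !) + 1#     ≈⟨ +-congʳ ([m!]²≈-1 even) ⟩
      -1# + 1#                   ≈⟨ -‿inverseˡ 1# ⟩
      0# ∎)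
      where
      x = (m !) ℕ.% p
      ιx : ι x ≈ ι (m !)
      ιx = sym (trans (reflexive (≡.cong ι (m≡m%n+[m/n]*n (m !) p))) (trans (+-homo (+ x) (+ (((m !) ℕ./ p) ℕ.* p)))
        (trans (+-congˡ (ι≈0-if-p∣ _ (divides ((m !) ℕ./ p) ≡.refl))) (+-identityʳ _))))

    legendre-unfold : legendre -[1+ 0 ] p ≡ (if isSquareMod p -[1+ 0 ] then + 1 else -[1+ 0 ])
    legendre-unfold with p ∣? 1
    ... | yes p∣1 = contradiction p∣1 p∤1
    ... | no _    = ≡.refl

    -- Euler's criterion for -1, matched with the search in `isSquareMod`. A root that is found
    -- gives (-1)^m = 1 by Fermat. If none is found, m is odd, since for even m the search would
    -- have met the root from `-1-square`.
    φ-legendre : φ (legendre -[1+ 0 ] p) ≈ -1# ^ m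
    φ-legendre = trans (reflexive (≡.cong φ legendre-unfold)) branches
      where
      squareRoot? : ℕ → Bool
      squareRoot? x = divides? p (+ (x ℕ.* x) ℤ.- -[1+ 0 ])
      branches : φ (if isSquareMod p -[1+ 0 ] then + 1 else -[1+ 0 ]) ≈ -1# ^ m
      branches with isSquareMod p -[1+ 0 ] in eq
      ... | true  = trans 1-homo (sym ([-1]^m≈1 x (∈-upTo⁻ x∈) (toWitness found)))
        where
        witness = find (any⁻ squareRoot? (upTo p) (≡.subst T (≡.sym eq) _))
        x = proj₁ witness
        x∈ = proj₁ (proj₂ witness)
        found = proj₂ (proj₂ witness)
      ... | false with parity m
      ...   | j , inj₂ m≡ = trans (-‿homo (+ 1)) (trans (-‿cong 1-homo) (sym (trans (reflexive (≡.cong (-1# ^_) m≡)) (trans (*-congˡ (-1^[m+m]≈1 j)) (*-identityʳ _)))))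
      ...   | j , inj₁ m≡ with -1-square (trans (reflexive (≡.cong (-1# ^_) m≡)) (-1^[m+m]≈1 j))
      ...     | x , x<p , p∣ = contradiction (≡.subst T eq (any⁺ squareRoot? (lose (∈-upTo⁺ x<p) (fromWitness p∣)))) id

  -- £₂ at - i, 1 + i and (1 - i)/2 in characteristic p

  module Values (m : ℕ) (n≡m+m : n ≡ m ℕ.+ m)
    (E : ℕ → Carrier) (E0≈1 : E 0 ≈ 1#) (E-odd : ∀ j → E (suc (j ℕ.+ j)) ≈ 0#)
    (E-even : ∀ j → binomialSum (suc j ℕ.+ suc j) E ≈ 0#)
    (I : Carrier) (I²≈-1 : I * I ≈ -1#) where

    open Euler E E0≈1 E-odd E-even

    ℓ : Carrier
    ℓ = -1# ^ m

    [-I]²≈-1 : (- I) * (- I) ≈ -1#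
    [-I]²≈-1 = trans (solve 1 (λ i → (:- i) :* (:- i) := i :* i) refl I) I²≈-1

    I*-I : ∀ {x} → x * x ≈ -1# → x * - x ≈ 1#
    I*-I {x} eq = trans (solve 1 (λ i → i :* (:- i) := :- (i :* i)) refl x) (trans (-‿cong eq) (solve 0 (:- (:- :1) := :1) refl))

    x^p : ∀ {x} → x * x ≈ -1# → x ^ p ≈ ℓ * x
    x^p {x} eq = trans (reflexive (≡.cong (λ i → x ^ suc i) n≡m+m)) (SquareRootOf-1.I^[1+m+m] x eq m)

    N : ℕ
    N = n ∸ 2

    n≡2+N : n ≡ 2 ℕ.+ N
    n≡2+N = ≡.sym (ℕₚ.m+[n∸m]≡n (ℕₚ.<⇒≤ 3≤n))

    a²≈ι^N : ∀ k → 0 < k → k < p → a k * a k ≈ ι k ^ N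
    a²≈ι^N k 0<k k<p = begin
      a k * a k                          ≈⟨ *-identityʳ _ ⟨
      (a k * a k) * 1#                   ≈⟨ *-congˡ (trans (sym (fermat k 0<k k<p)) (reflexive (≡.cong (ι k ^_) n≡2+N))) ⟩
      (a k * a k) * (ι k * (ι k * ι k ^ N)) ≈⟨ solve 3 (λ a i x → (a :* a) :* (i :* (i :* x)) := ((i :* a) :* (i :* a)) :* x) refl _ _ _ ⟩
      ((ι k * a k) * (ι k * a k)) * ι k ^ N ≈⟨ trans (*-congʳ (trans (*-cong (a-inverse k 0<k k<p) (a-inverse k 0<k k<p)) (*-identityˡ _))) (*-identityˡ _) ⟩
      ι k ^ N ∎

    -- Zero at even k and 2 I^k at odd k: these weights restrict the difference of `Li₂` at I and -
    -- I to odd k.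
    c : ℕ → Carrier
    c k = I ^ k - (- I) ^ k

    c-step : ∀ k → c (suc (suc k)) ≈ - c k
    c-step k = trans (solve 3 (λ i x y → i :* (i :* x) :- (:- i) :* ((:- i) :* y) := (i :* i) :* (x :- y)) refl I _ _)
      (trans (*-congʳ I²≈-1) (solve 1 (λ u → (:- :1) :* u := :- u) refl _))

    c-even : ∀ j → c (j ℕ.+ j) ≈ 0#
    c-even j = trans (+-cong (SquareRootOf-1.I^[m+m] I I²≈-1 j) (-‿cong (SquareRootOf-1.I^[m+m] (- I) [-I]²≈-1 j))) (-‿inverseʳ _)

    -- Σ c(k) (F(k + 1) + F(k - 1)) telescopes because c(k + 2) = - c(k).
    telescope : ∀ M → Σ< M (λ k → c k * (F N (ι k + 1#) + F N (ι k - 1#))) ≈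
      (c 0 * F N (ι 0 - 1#) + c 1 * F N (ι 1 - 1#)) - (c M * F N (ι M - 1#) + c (suc M) * F N (ι (suc M) - 1#))
    telescope zero    = sym (-‿inverseʳ _)
    telescope (suc M) = begin
      Σ< M (λ k → c k * (F N (ι k + 1#) + F N (ι k - 1#))) + c M * (F N (ι M + 1#) + F N (ι M - 1#))
        ≈⟨ +-cong (telescope M) (*-congˡ (+-congʳ (B-congₜ N E ι+1))) ⟩
      (u - (c M * F N (ι M - 1#) + w)) + c M * (f + F N (ι M - 1#))
        ≈⟨ solve 5 (λ u c g w f → (u :- (c :* g :+ w)) :+ c :* (f :+ g) := u :- (w :+ (:- c) :* f)) refl u (c M) (F N (ι M - 1#)) w f ⟩
      u - (w + - c M * f)
        ≈⟨ +-congˡ (-‿cong (+-congˡ (*-congʳ (c-step M)))) ⟨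
      u - (w + c (suc (suc M)) * f) ∎
      where
      u = c 0 * F N (ι 0 - 1#) + c 1 * F N (ι 1 - 1#)
      w = c (suc M) * F N (ι (suc M) - 1#)
      f = F N (ι (suc (suc M)) - 1#)
      ι+1 : ι M + 1# ≈ ι (suc (suc M)) - 1#
      ι+1 = trans (solve 1 (λ i → i :+ :1 := (:1 :+ (:1 :+ i)) :- :1) refl _) (+-congʳ (sym (trans (ι-suc (suc M)) (+-congˡ (ι-suc M)))))

    -- Here p - 1 is -1, and N = p - 3 is even and positive, so this is the recurrence of the Euler
    -- numbers.
    F[p-1]≈0 : F N (ι p - 1#) ≈ 0#
    F[p-1]≈0 = trans (B-congₜ N E (trans (+-congʳ p≈0) (+-identityˡ _))) (even N _ N-even)
      where
      even : ∀ N j → N ≡ suc j ℕ.+ suc j → F N -1# ≈ 0#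
      even _ j ≡.refl = F[-1]-even j
      N-even : N ≡ suc (m ∸ 2) ℕ.+ suc (m ∸ 2)
      N-even = half m n≡m+m 3≤n
        where
        half : ∀ m → n ≡ m ℕ.+ m → 3 ≤ n → n ∸ 2 ≡ suc (m ∸ 2) ℕ.+ suc (m ∸ 2)
        half (suc (suc m)) ≡.refl _ = ≡.trans (ℕₚ.+-suc m (suc m)) (≡.cong suc (≡.refl {x = m ℕ.+ suc m}))
        half (suc zero) ≡.refl (s≤s (s≤s ()))

    Li₂[I]-Li₂[-I] : Li₂ I - Li₂ (- I) ≈ I * E N
    Li₂[I]-Li₂[-I] = trans (solve 2 (λ u v → u := (u :- v) :+ v) refl _ (I * E N)) (trans (+-congʳ (double-cancel difference)) (+-identityˡ _))
      where
      summand : ∀ k → k < p → (1# + 1#) * ((a k * a k) * I ^ k + - ((a k * a k) * (- I) ^ k)) ≈ c k * (F N (ι k + 1#) + F N (ι k - 1#))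
      summand zero    _   = solve 2 (λ u v → (:1 :+ :1) :* (u :* :1 :+ :- (u :* :1)) := (:1 :- :1) :* v) refl _ _
      summand (suc k) k<p = begin
        (1# + 1#) * (q * I ^ suc k + - (q * (- I) ^ suc k)) ≈⟨ solve 3 (λ q x y → (:1 :+ :1) :* (q :* x :+ :- (q :* y)) := (x :- y) :* ((:1 :+ :1) :* q)) refl q _ _ ⟩
        c (suc k) * ((1# + 1#) * q)                         ≈⟨ *-congˡ (*-congˡ (a²≈ι^N (suc k) (s≤s z≤n) k<p)) ⟩
        c (suc k) * ((1# + 1#) * ι (suc k) ^ N)             ≈⟨ *-congˡ (F-equation N (ι (suc k))) ⟨
        c (suc k) * (F N (ι (suc k) + 1#) + F N (ι (suc k) - 1#)) ∎
        where q = a (suc k) * a (suc k)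
      difference : ((Li₂ I - Li₂ (- I)) - I * E N) + ((Li₂ I - Li₂ (- I)) - I * E N) ≈ 0#
      difference = begin
        ((Li₂ I - Li₂ (- I)) - I * E N) + ((Li₂ I - Li₂ (- I)) - I * E N)
          ≈⟨ solve 3 (λ s t e → ((s :- t) :- e) :+ ((s :- t) :- e) := (:1 :+ :1) :* (s :+ :- t) :- (e :+ e)) refl _ _ _ ⟩
        (1# + 1#) * (Li₂ I + - Li₂ (- I)) - (I * E N + I * E N)
          ≈⟨ +-congʳ (trans (*-congˡ (trans (+-congˡ (sym (Σ-neg p _))) (sym (Σ-+ p _ _)))) (trans (sym (Σ-* p _ _)) (Σ-cong p summand))) ⟩
        Σ< p (λ k → c k * (F N (ι k + 1#) + F N (ι k - 1#))) - (I * E N + I * E N)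
          ≈⟨ +-congʳ (telescope p) ⟩
        ((c 0 * F N (ι 0 - 1#) + c 1 * F N (ι 1 - 1#)) - (c p * F N (ι p - 1#) + c (suc p) * F N (ι (suc p) - 1#))) - (I * E N + I * E N)
          -- Of the four boundary terms only `c 1` times F(0) = E N survives, and `c 1` is 2 I. The
          -- weights at the even indices 0 and p + 1 vanish, and so does F at p - 1.
          ≈⟨ +-congʳ (+-cong (+-cong (trans (*-congʳ (-‿inverseʳ 1#)) (zeroˡ _)) (*-congˡ (trans (B-congₜ N E (trans (+-congʳ 1-homo) (-‿inverseʳ 1#))) (F[0] N))))
               (-‿cong (+-cong (trans (*-congˡ F[p-1]≈0) (zeroʳ _)) (trans (*-congʳ c[1+p]≈0) (zeroˡ _))))) ⟩
        ((0# + c 1 * E N) - (0# + 0#)) - (I * E N + I * E N)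
          ≈⟨ solve 2 (λ i e → ((con (+ 0) :+ (i :* :1 :- (:- i) :* :1) :* e) :- (con (+ 0) :+ con (+ 0))) :- (i :* e :+ i :* e) := con (+ 0)) refl I (E N) ⟩
        0# ∎
        where
        c[1+p]≈0 : c (suc p) ≈ 0#
        c[1+p]≈0 = trans (reflexive (≡.cong c (≡.trans (≡.cong (λ i → suc (suc i)) n≡m+m) (≡.cong suc (≡.sym (ℕₚ.+-suc m m)))))) (c-even (suc m))

    -- The symmetry x ↦ 1/x rewrites one copy of Li₂(- I) as - ℓ I Li₂(I), which leaves a multiple
    -- of the difference just computed. The factor 1 + ℓ I stays, as the evaluation at 1 + I asks
    -- for exactly this product.
    Li₂[-I] : (1# + ℓ * I) * Li₂ (- I) ≈ ℓ * E N
    Li₂[-I] = begin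
      (1# + ℓ * I) * S
        ≈⟨ solve 3 (λ l i s → (:1 :+ l :* i) :* s := s :+ l :* i :* s) refl ℓ I S ⟩
      S + ℓ * I * S
        ≈⟨ +-congʳ (trans (sym (Reciprocal.x^p*Li₂[y] (- I) I (trans (*-comm _ _) (I*-I I²≈-1)))) (*-congʳ (x^p [-I]²≈-1))) ⟩
      ℓ * - I * T′ + ℓ * I * S
        ≈⟨ solve 4 (λ l i s t → l :* (:- i) :* t :+ l :* i :* s := :- (l :* i) :* (t :- s)) refl ℓ I S T′ ⟩
      - (ℓ * I) * (T′ - S)
        ≈⟨ *-congˡ Li₂[I]-Li₂[-I] ⟩
      - (ℓ * I) * (I * E N)
        ≈⟨ solve 3 (λ l i e → :- (l :* i) :* (i :* e) := (:- (i :* i)) :* (l :* e)) refl ℓ I (E N) ⟩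
      - (I * I) * (ℓ * E N)
        ≈⟨ *-congʳ (trans (-‿cong I²≈-1) (solve 0 (:- (:- :1) := :1) refl)) ⟩
      1# * (ℓ * E N)
        ≈⟨ *-identityˡ _ ⟩
      ℓ * E N ∎
      where
      S = Li₂ (- I)
      T′ = Li₂ I

    module _ (s : Carrier) (Li₁[-I] : Li₁ (- I) ≈ - (s * (1# + ℓ * I))) where

      ℓI² : (ℓ * I) * (ℓ * I) ≈ -1#
      ℓI² = trans (solve 2 (λ l i → (l :* i) :* (l :* i) := (l :* l) :* (i :* i)) refl ℓ I) (trans (*-cong (±1*±1≈1 m) I²≈-1) (*-identityˡ _))

      -- Li₁² at x = - I, multiplied by 1 - ℓ I to clear the factor 1 - x^p = 1 + ℓ I.
      Li₂[1+I]-doubled : (1# + 1#) * Li₂ (1# + I) ≈ ℓ * E N - (s * s) * (1# + ℓ * I)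
      Li₂[1+I]-doubled = begin
        (1# + 1#) * W
          ≈⟨ solve 1 (λ w → (:1 :+ :1) :* w := (:1 :- (:- :1)) :* w) refl W ⟩
        (1# - -1#) * W
          ≈⟨ *-congʳ (+-congˡ (-‿cong (sym ℓI²))) ⟩
        (1# - j * j) * W
          ≈⟨ solve 2 (λ j w → (:1 :- j :* j) :* w := (:1 :- j) :* ((:1 :+ j) :* w)) refl j W ⟩
        (1# - j) * ((1# + j) * W)
          ≈⟨ *-congˡ (solve 3 (λ j w t → (:1 :+ j) :* w := ((:1 :- (:- j)) :* w :+ (:- j) :* t) :+ j :* t) refl j W S) ⟩
        (1# - j) * (((1# - - j) * W + - j * S) + j * S)
          ≈⟨ *-congˡ (+-congʳ granville) ⟩
        (1# - j) * (- ((s * s) * j) + j * S)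
          ≈⟨ solve 3 (λ j t s → (:1 :- j) :* (:- ((s :* s) :* j) :+ j :* t) := (j :- j :* j) :* t :- (s :* s) :* (j :- j :* j)) refl j S s ⟩
        (j - j * j) * S - (s * s) * (j - j * j)
          ≈⟨ +-cong (*-congʳ j-j²) (-‿cong (*-congˡ j-j²)) ⟩
        (1# + j) * S - (s * s) * (1# + j)
          ≈⟨ +-congʳ Li₂[-I] ⟩
        ℓ * E N - (s * s) * (1# + j) ∎
        where
        j = ℓ * I
        W = Li₂ (1# + I)
        S = Li₂ (- I)
        j-j² : j - j * j ≈ 1# + j
        j-j² = trans (+-congˡ (-‿cong ℓI²)) (solve 1 (λ j → j :- (:- :1) := :1 :+ j) refl j)
        W≈ : Li₂ (1# - - I) ≈ W
        W≈ = Σ-cong p λ k _ → *-congˡ (^-congˡ k (solve 1 (λ i → :1 :- (:- i) := :1 :+ i) refl I))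
        [-I]^p : (- I) ^ p ≈ - j
        [-I]^p = trans (x^p [-I]²≈-1) (solve 2 (λ l i → l :* (:- i) := :- (l :* i)) refl ℓ I)
        -- As (1 + j)² = 2 j, `Li₁²` at - I says that 2 s² j is -2 times the bracket; `granville`
        -- then cancels the 2.
        two : (1# + 1#) * ((s * s) * j + ((1# - - j) * W + - j * S)) ≈ 0#
        two = begin
          (1# + 1#) * ((s * s) * j + X)
            ≈⟨ solve 3 (λ s j x → (:1 :+ :1) :* ((s :* s) :* j :+ x) := ((:- (s :* (:1 :+ j))) :* (:- (s :* (:1 :+ j))) :- (s :* s) :* (:1 :+ j :* j)) :- (:- (:1 :+ :1)) :* x) refl s j X ⟩
          (- (s * (1# + j)) * - (s * (1# + j)) - (s * s) * (1# + j * j)) - - (1# + 1#) * X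
            ≈⟨ +-cong (+-cong (trans (*-cong (sym Li₁[-I]) (sym Li₁[-I])) (trans (Li₁² (- I) I (trans (*-comm _ _) (I*-I I²≈-1)))
                 (*-congˡ (+-cong (*-cong (+-congˡ (-‿cong [-I]^p)) W≈) (*-congʳ [-I]^p)))))
                 (-‿cong (trans (*-congˡ (trans (+-congˡ ℓI²) (-‿inverseʳ 1#))) (zeroʳ _)))) refl ⟩
          (- (1# + 1#) * X - 0#) - - (1# + 1#) * X
            ≈⟨ solve 1 (λ x → (x :- con (+ 0)) :- x := con (+ 0)) refl _ ⟩
          0# ∎
          where X = (1# - - j) * W + - j * S
        granville : (1# - - j) * W + - j * S ≈ - ((s * s) * j)
        granville = trans (solve 2 (λ x q → x := (q :+ x) :- q) refl _ ((s * s) * j))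
          (trans (+-congʳ (ι-cancel 2 (s≤s z≤n) 2<p (trans (*-congʳ ι2≈1+1) two))) (+-identityˡ _))

      a₂ : Carrier
      a₂ = a 2

      2a₂≈1 : (1# + 1#) * a₂ ≈ 1#
      2a₂≈1 = trans (*-congʳ (sym ι2≈1+1)) (a-inverse 2 (s≤s z≤n) 2<p)

      Li₂[1+I] : Li₂ (1# + I) ≈ a₂ * (ℓ * E N - (s * s) * (1# + ℓ * I))
      Li₂[1+I] = begin
        W                            ≈⟨ trans (sym (*-identityˡ _)) (*-congʳ (sym 2a₂≈1)) ⟩
        ((1# + 1#) * a₂) * W         ≈⟨ solve 2 (λ b w → ((:1 :+ :1) :* b) :* w := b :* ((:1 :+ :1) :* w)) refl a₂ W ⟩
        a₂ * ((1# + 1#) * W)         ≈⟨ *-congˡ Li₂[1+I]-doubled ⟩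
        a₂ * (ℓ * E N - (s * s) * (1# + ℓ * I)) ∎
        where W = Li₂ (1# + I)

      a₂^p≈a₂ : a₂ ^ p ≈ a₂
      a₂^p≈a₂ = begin
        a₂ ^ p                         ≈⟨ *-identityʳ _ ⟨
        a₂ ^ p * 1#                    ≈⟨ *-congˡ (a-inverse 2 (s≤s z≤n) 2<p) ⟨
        a₂ ^ p * (ι 2 * a₂)            ≈⟨ *-congˡ (*-congʳ (sym (ι^p 2))) ⟩
        a₂ ^ p * (ι 2 ^ p * a₂)        ≈⟨ trans (solve 3 (λ x y z → x :* (y :* z) := (y :* x) :* z) refl _ _ _) (*-congʳ (sym (^-distrib-* (ι 2) a₂ p))) ⟩
        (ι 2 * a₂) ^ p * a₂            ≈⟨ *-congʳ (trans (^-congˡ p (a-inverse 2 (s≤s z≤n) 2<p)) (1^n≈1 p)) ⟩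
        1# * a₂                        ≈⟨ *-identityˡ _ ⟩
        a₂ ∎

      -- Here the reciprocal of (1 - I)/2 is 1 + I.
      Li₂[[1-I]/2] : Li₂ (a₂ + (- I) * a₂) ≈ (a₂ * a₂) * ((ℓ + - I) * E N) - a₂ * (s * s)
      Li₂[[1-I]/2] = begin
        Li₂ x
          ≈⟨ Reciprocal.x^p*Li₂[y] x (1# + I) xy≈1 ⟨
        x ^ p * Li₂ (1# + I)
          ≈⟨ *-cong x^p≈ Li₂[1+I] ⟩
        ((1# - ℓ * I) * a₂) * (a₂ * (ℓ * e - (s * s) * (1# + ℓ * I)))
          -- Since ℓ² = 1, multiplying by 1 - ℓ I turns ℓ into ℓ - I in the Euler term and 1 + ℓ I
          -- into 2 in the other one, where ℓ thereby disappears.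
          ≈⟨ solve 5 (λ l i b e s → ((:1 :- l :* i) :* b) :* (b :* (l :* e :- (s :* s) :* (:1 :+ l :* i)))
               := (b :* b) :* ((l :- (l :* l) :* i) :* e) :- (b :* b) :* ((s :* s) :* (:1 :- (l :* i) :* (l :* i)))) refl ℓ I a₂ e s ⟩
        (a₂ * a₂) * ((ℓ - (ℓ * ℓ) * I) * e) - (a₂ * a₂) * ((s * s) * (1# - (ℓ * I) * (ℓ * I)))
          ≈⟨ +-cong (*-congˡ (*-congʳ (+-congˡ (-‿cong (trans (*-congʳ (±1*±1≈1 m)) (*-identityˡ _))))))
                    (-‿cong (*-congˡ (*-congˡ (+-congˡ (-‿cong ℓI²))))) ⟩
        (a₂ * a₂) * ((ℓ - I) * e) - (a₂ * a₂) * ((s * s) * (1# - -1#))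
          ≈⟨ +-congˡ (-‿cong (solve 2 (λ b s → (b :* b) :* ((s :* s) :* (:1 :- (:- :1))) := ((:1 :+ :1) :* b) :* (b :* (s :* s))) refl a₂ s)) ⟩
        (a₂ * a₂) * ((ℓ - I) * e) - ((1# + 1#) * a₂) * (a₂ * (s * s))
          ≈⟨ +-congˡ (-‿cong (trans (*-congʳ 2a₂≈1) (*-identityˡ _))) ⟩
        (a₂ * a₂) * ((ℓ + - I) * e) - a₂ * (s * s) ∎
        where
        e = E N
        x = a₂ + (- I) * a₂
        x≈ : x ≈ (1# + - I) * a₂
        x≈ = solve 2 (λ i b → b :+ (:- i) :* b := (:1 :+ :- i) :* b) refl I a₂
        xy≈1 : x * (1# + I) ≈ 1#
        xy≈1 = begin
          x * (1# + I)               ≈⟨ solve 2 (λ i b → (b :+ (:- i) :* b) :* (:1 :+ i) := (:1 :- i :* i) :* b) refl I a₂ ⟩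
          (1# - I * I) * a₂          ≈⟨ *-congʳ (trans (+-congˡ (-‿cong I²≈-1)) (solve 0 (:1 :- (:- :1) := :1 :+ :1) refl)) ⟩
          (1# + 1#) * a₂             ≈⟨ 2a₂≈1 ⟩
          1# ∎
        x^p≈ : x ^ p ≈ (1# - ℓ * I) * a₂
        x^p≈ = begin
          x ^ p                       ≈⟨ ^-congˡ p x≈ ⟩
          ((1# + - I) * a₂) ^ p       ≈⟨ ^-distrib-* _ a₂ p ⟩
          (1# + - I) ^ p * a₂ ^ p     ≈⟨ *-cong (trans (^-congˡ p (+-comm _ _)) (trans ([x+1]^p (- I)) (+-congʳ (x^p [-I]²≈-1)))) a₂^p≈a₂ ⟩
          (ℓ * - I + 1#) * a₂         ≈⟨ *-congʳ (solve 2 (λ l i → l :* (:- i) :+ :1 := :1 :- l :* i) refl ℓ I) ⟩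
          (1# - ℓ * I) * a₂ ∎

      -- The coefficients are arbitrary elements congruent to the expected ones, so that the literal
      -- rationals of the theorem can be substituted. With s = q/2 the coefficient s²/2 becomes
      -- q²/8.
      formula₁ : ∀ {q C j l H} → q ≈ s + s → C ≈ - (q * q * (a₂ * a₂ * a₂)) → j ≈ I → l ≈ ℓ → H ≈ a₂ * l * E N →
                 Li₂ (1# + I) ≈ C * (1# + j * l) + H
      formula₁ {q} {C} {j} {l} {H} q≈ C≈ j≈ l≈ H≈ = begin
        Li₂ (1# + I)
          ≈⟨ Li₂[1+I] ⟩
        a₂ * (ℓ * E N - (s * s) * (1# + ℓ * I))
          -- The factor 1 * 1 is a placeholder for (2 a₂)², which turns s² a₂ into (2 s)² a₂³.
          ≈⟨ solve 5 (λ b l e s i → b :* (l :* e :- (s :* s) :* (:1 :+ l :* i)) := (:- ((s :* s) :* (:1 :* :1) :* b)) :* (:1 :+ i :* l) :+ b :* l :* e) refl a₂ ℓ (E N) s I ⟩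
        - ((s * s) * (1# * 1#) * a₂) * (1# + I * ℓ) + a₂ * ℓ * E N
          ≈⟨ +-cong (*-cong (trans (-‿cong (trans (*-congʳ (*-congˡ (*-cong (sym 2a₂≈1) (sym 2a₂≈1))))
                 (trans (solve 2 (λ s b → (s :* s) :* (((:1 :+ :1) :* b) :* ((:1 :+ :1) :* b)) :* b := (s :+ s) :* (s :+ s) :* (b :* b :* b)) refl s a₂) (*-congʳ (*-cong (sym q≈) (sym q≈)))))) (sym C≈))
               (+-congˡ (*-cong (sym j≈) (sym l≈)))) (trans (*-congʳ (*-congˡ (sym l≈))) (sym H≈)) ⟩
        C * (1# + j * l) + H ∎

      formula₂ : ∀ {q C j l F} → q ≈ s + s → C ≈ - (q * q * (a₂ * a₂ * a₂)) → j ≈ - I → l ≈ ℓ → F ≈ a₂ * a₂ →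
                 Li₂ (a₂ + (- I) * a₂) ≈ C + F * (l + j) * E N
      formula₂ {q} {C} {j} {l} {F} q≈ C≈ j≈ l≈ F≈ = begin
        Li₂ (a₂ + (- I) * a₂)
          ≈⟨ Li₂[[1-I]/2] ⟩
        (a₂ * a₂) * ((ℓ + - I) * E N) - a₂ * (s * s)
          ≈⟨ solve 5 (λ b l e s i → (b :* b) :* ((l :+ i) :* e) :- b :* (s :* s) := (:- ((s :* s) :* (:1 :* :1) :* b)) :+ (b :* b) :* (l :+ i) :* e) refl a₂ ℓ (E N) s (- I) ⟩
        - ((s * s) * (1# * 1#) * a₂) + (a₂ * a₂) * (ℓ + - I) * E N
          ≈⟨ +-cong (trans (-‿cong (trans (*-congʳ (*-congˡ (*-cong (sym 2a₂≈1) (sym 2a₂≈1))))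
                 (trans (solve 2 (λ s b → (s :* s) :* (((:1 :+ :1) :* b) :* ((:1 :+ :1) :* b)) :* b := (s :+ s) :* (s :+ s) :* (b :* b :* b)) refl s a₂) (*-congʳ (*-cong (sym q≈) (sym q≈)))))) (sym C≈))
               (*-congʳ (*-cong (sym F≈) (+-cong (sym l≈) (sym j≈)))) ⟩
        C + F * (l + j) * E N ∎

-- Euler numbers

nth : List ℤ → ℕ → ℤ
nth []       _       = + 0
nth (e ∷ es) zero    = e
nth (e ∷ es) (suc k) = nth es k

-- The first argument of `g` stands for the variable of the enclosing `eulerNumber`, which its local
-- lookup carries along as a parameter.
nth-unique : (g : ℕ → List ℤ → ℕ → ℤ) → (∀ m k → g m [] k ≡ + 0) → (∀ m e es → g m (e ∷ es) 0 ≡ e) →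
             (∀ m e es k → g m (e ∷ es) (suc k) ≡ g m es k) → ∀ m es k → g m es k ≡ nth es k
nth-unique g g[] g0 gs m []       k       = g[] m k
nth-unique g g[] g0 gs m (e ∷ es) zero    = g0 m e es
nth-unique g g[] g0 gs m (e ∷ es) (suc k) = ≡.trans (gs m e es k) (nth-unique g g[] g0 gs m es k)

-- The list lookup inside Defs.eulerNumber has no name in scope; unification recovers it
-- once the list and the implicit copy of the index have been abstracted separately.
mutual
  eulerLookup : ℕ → List ℤ → ℕ → ℤ
  eulerLookup = _

  eulerNumber≡nth : ∀ n → eulerNumber n ≡ nth (eulerUpTo n) n
  eulerNumber≡nth zero = ≡.refl
  eulerNumber≡nth (suc n) with eulerUpTo (suc n)
  ... | [] = ≡.refl
  ... | e ∷ es with suc n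
  ... | m = nth-unique eulerLookup (λ _ _ → ≡.refl) (λ _ _ _ → ≡.refl) (λ _ _ _ _ → ≡.refl) m es n

ℤ→ℤ : IntegersTo ℤₚ.+-*-commutativeRing
ℤ→ℤ = record
  { φ = id ; +-homo = λ _ _ → ≡.refl ; *-homo = λ _ _ → ≡.refl ; -‿homo = λ _ → ≡.refl ; 0-homo = ≡.refl ; 1-homo = ≡.refl }

module ℤΣ = RingSums ℤₚ.+-*-commutativeRing ℤ→ℤ

nth-++ˡ : ∀ xs {ys} k → k < length xs → nth (xs ++ ys) k ≡ nth xs k
nth-++ˡ (x ∷ xs) zero    _         = ≡.refl
nth-++ˡ (x ∷ xs) (suc k) (s≤s k<l) = nth-++ˡ xs k k<l

nth-last : ∀ xs y → nth (xs ++ (y ∷ [])) (length xs) ≡ y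
nth-last []       y = ≡.refl
nth-last (x ∷ xs) y = nth-last xs y

length-eulerUpTo : ∀ n → length (eulerUpTo n) ≡ suc n
length-eulerUpTo zero    = ≡.refl
length-eulerUpTo (suc n) = ≡.trans (Listₚ.length-++ (eulerUpTo n)) (≡.trans (ℕₚ.+-comm _ 1) (≡.cong suc (length-eulerUpTo n)))

nth-eulerUpTo : ∀ n k → k ≤ n → nth (eulerUpTo n) k ≡ eulerNumber k
nth-eulerUpTo n k k≤n = extend n (ℕₚ.≤⇒≤′ k≤n)
  where
  extend : ∀ n → k ℕ.≤′ n → nth (eulerUpTo n) k ≡ eulerNumber k
  extend n       (ℕ.≤′-reflexive ≡.refl) = ≡.sym (eulerNumber≡nth k)
  extend (suc n) (ℕ.≤′-step k≤′n)      = ≡.trans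
    (nth-++ˡ (eulerUpTo n) k (≡.subst (k <_) (≡.sym (length-eulerUpTo n)) (s≤s (ℕₚ.≤′⇒≤ k≤′n)))) (extend n k≤′n)

nth-last-eulerUpTo : ∀ n y → nth (eulerUpTo n ++ (y ∷ [])) (suc n) ≡ y
nth-last-eulerUpTo n y = ≡.trans (≡.cong (nth (eulerUpTo n ++ (y ∷ []))) (≡.sym (length-eulerUpTo n))) (nth-last (eulerUpTo n) y)

[j+j]%2≡0 : ∀ j → (j ℕ.+ j) ℕ.% 2 ≡ 0
[j+j]%2≡0 j = ≡.trans (≡.cong (ℕ._% 2) (≡.trans (≡.cong (j ℕ.+_) (≡.sym (ℕₚ.+-identityʳ j))) (ℕₚ.*-comm 2 j))) (m*n%n≡0 j 2)

[1+j+j]%2≡1 : ∀ j → suc (j ℕ.+ j) ℕ.% 2 ≡ 1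
[1+j+j]%2≡1 j = ≡.trans (≡.cong (λ i → suc i ℕ.% 2) (≡.trans (≡.cong (j ℕ.+_) (≡.sym (ℕₚ.+-identityʳ j))) (ℕₚ.*-comm 2 j))) ([m+kn]%n≡m%n 1 j 2)

private
  -- The parity test in the private `nextEuler` is evaluated with arbitrary branches, which
  -- unification can then fill in.
  if-odd : ∀ j (x y : ℤ) → (if (suc (j ℕ.+ j) ℕ.% 2) ℕ.≡ᵇ 0 then x else y) ≡ y
  if-odd j x y rewrite [1+j+j]%2≡1 j = ≡.refl

  if-even : ∀ n j (x y : ℤ) → n ≡ j ℕ.+ j → (if (n ℕ.% 2) ℕ.≡ᵇ 0 then x else y) ≡ x
  if-even _ j x y ≡.refl rewrite [j+j]%2≡0 j = ≡.refl

eulerNumber-odd : ∀ j → eulerNumber (suc (j ℕ.+ j)) ≡ + 0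
eulerNumber-odd j = ≡.trans (eulerNumber≡nth (suc (j ℕ.+ j)))
  (≡.trans (nth-last-eulerUpTo (j ℕ.+ j) _) (if-odd j _ _))

foldr-zip : ∀ (f : ℕ × ℤ → ℤ) g es →
  foldr ℤ._+_ (+ 0) (map f (zip (applyUpTo g (length es)) es)) ≡ ℤΣ.Σ< (length es) (λ j → f (g j , nth es j))
foldr-zip f g []       = ≡.refl
foldr-zip f g (e ∷ es) = ≡.trans (≡.cong (λ x → f (g 0 , e) ℤ.+ x) (foldr-zip f (g ∘ suc) es)) (≡.sym (ℤΣ.Σ-head (length es) _))

eulerNumber-even : ∀ n j → suc n ≡ j ℕ.+ j →
  eulerNumber (suc n) ≡ ℤ.- ℤΣ.Σ< (suc n) (λ k → + (suc n C k) ℤ.* eulerNumber k)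
eulerNumber-even n j eq = ≡.trans (eulerNumber≡nth (suc n)) (≡.trans (nth-last-eulerUpTo n _) (≡.trans (if-even (suc n) j _ _ eq)
  (≡.cong ℤ.-_ (≡.trans (≡.cong (λ l → foldr ℤ._+_ (+ 0) (map f (zip (upTo l) (eulerUpTo n)))) (≡.sym (length-eulerUpTo n)))
    (≡.trans (foldr-zip f id (eulerUpTo n)) (≡.trans (≡.cong (λ l → ℤΣ.Σ< l (λ k → f (k , nth (eulerUpTo n) k))) (length-eulerUpTo n))
      (ℤΣ.Σ-cong (suc n) λ k k<1+n → ≡.cong (+ (suc n C k) ℤ.*_) (nth-eulerUpTo n k (ℕₚ.≤-pred k<1+n)))))))))
  where
  f : ℕ × ℤ → ℤ
  f (k , e) = + (suc n C k) ℤ.* e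

eulerNumber-recurrence : ∀ j → ℤΣ.binomialSum (suc j ℕ.+ suc j) eulerNumber ≡ + 0
eulerNumber-recurrence j = ≡.trans (≡.cong (λ x → S ℤ.+ x) (≡.trans (≡.cong₂ (λ c e → + c ℤ.* e) (nCn≡1 m) (eulerNumber-even (j ℕ.+ suc j) (suc j) ≡.refl))
                                                   (ℤₚ.*-identityˡ _))) (ℤₚ.+-inverseʳ S)
  where
  m = suc (j ℕ.+ suc j)
  S = ℤΣ.Σ< m (λ k → + (m C k) ℤ.* eulerNumber k)

module EulerNumbersIn (R : CommutativeRing 0ℓ 0ℓ) (ℤ→R : IntegersTo R) where

  open RingSums R ℤ→R

  φ-Σ : ∀ n f → φ (ℤΣ.Σ< n f) ≈ Σ< n (φ ∘ f)
  φ-Σ zero    f = 0-homo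
  φ-Σ (suc n) f = trans (+-homo _ _) (+-congʳ (φ-Σ n f))

  E : ℕ → Carrier
  E k = φ (eulerNumber k)

  E-odd : ∀ j → E (suc (j ℕ.+ j)) ≈ 0#
  E-odd j = trans (reflexive (≡.cong φ (eulerNumber-odd j))) 0-homo

  E-even : ∀ j → binomialSum (suc j ℕ.+ suc j) E ≈ 0#
  E-even j = begin
    binomialSum k E
      ≈⟨ Σ-cong (suc k) (λ i _ → sym (*-homo (+ (k C i)) (eulerNumber i))) ⟩
    Σ< (suc k) (λ i → φ (+ (k C i) ℤ.* eulerNumber i))
      ≈⟨ φ-Σ (suc k) (λ i → + (k C i) ℤ.* eulerNumber i) ⟨
    φ (ℤΣ.binomialSum k eulerNumber)
      ≈⟨ trans (reflexive (≡.cong φ (eulerNumber-recurrence j))) 0-homo ⟩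
    0# ∎
    where k = suc j ℕ.+ suc j

-- Gaussian rationals modulo p

open import Defs

-- Reduction to lowest terms blocks computation with quotients. They are therefore written as
-- `fromℚᵘ` of an unreduced fraction, where equality is cross-multiplication.
fromℚᵘ-* : ∀ x y → fromℚᵘ x ℚ.* fromℚᵘ y ≡ fromℚᵘ (x ℚᵘ.* y)
fromℚᵘ-* x y = ℚₚ.toℚᵘ-injective (ℚᵘₚ.≃-trans (ℚₚ.toℚᵘ-homo-* (fromℚᵘ x) (fromℚᵘ y))
  (ℚᵘₚ.≃-trans (ℚᵘₚ.*-cong (ℚₚ.toℚᵘ-fromℚᵘ x) (ℚₚ.toℚᵘ-fromℚᵘ y)) (ℚᵘₚ.≃-sym (ℚₚ.toℚᵘ-fromℚᵘ (x ℚᵘ.* y)))))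

fromℚᵘ-+ : ∀ x y → fromℚᵘ x ℚ.+ fromℚᵘ y ≡ fromℚᵘ (x ℚᵘ.+ y)
fromℚᵘ-+ x y = ℚₚ.toℚᵘ-injective (ℚᵘₚ.≃-trans (ℚₚ.toℚᵘ-homo-+ (fromℚᵘ x) (fromℚᵘ y))
  (ℚᵘₚ.≃-trans (ℚᵘₚ.+-cong (ℚₚ.toℚᵘ-fromℚᵘ x) (ℚₚ.toℚᵘ-fromℚᵘ y)) (ℚᵘₚ.≃-sym (ℚₚ.toℚᵘ-fromℚᵘ (x ℚᵘ.+ y)))))

fromℚᵘ-neg : ∀ x → ℚ.- fromℚᵘ x ≡ fromℚᵘ (ℚᵘ.- x)
fromℚᵘ-neg x = ℚₚ.toℚᵘ-injective (ℚᵘₚ.≃-trans (ℚₚ.toℚᵘ-homo‿- (fromℚᵘ x))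
  (ℚᵘₚ.≃-trans (ℚᵘₚ.-‿cong (ℚₚ.toℚᵘ-fromℚᵘ x)) (ℚᵘₚ.≃-sym (ℚₚ.toℚᵘ-fromℚᵘ (ℚᵘ.- x)))))

k*1/k≡1 : ∀ k → (+ suc k ℚ./ 1) ℚ.* frac (+ 1) (suc k) ≡ 1ℚ
k*1/k≡1 k = ≡.trans (fromℚᵘ-* (mkℚᵘ (+ suc k) 0) (mkℚᵘ (+ 1) k))
  (ℚₚ.fromℚᵘ-cong {mkℚᵘ (+ suc k) 0 ℚᵘ.* mkℚᵘ (+ 1) k} {ℚᵘ.1ℚᵘ} (*≡* (≡.trans (ℤₚ.*-identityʳ _)
    (≡.trans (ℤₚ.*-identityʳ (+ suc k)) (≡.sym (≡.trans (ℤₚ.*-identityˡ _) (≡.cong +_ (ℕₚ.*-identityˡ (suc k)))))))))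

frac-* : ∀ z k → frac z (suc k) ≡ frac (+ 1) (suc k) ℚ.* (z ℚ./ 1)
frac-* z k = ≡.sym (≡.trans (fromℚᵘ-* (mkℚᵘ (+ 1) k) (mkℚᵘ z 0))
  (ℚₚ.fromℚᵘ-cong {mkℚᵘ (+ 1) k ℚᵘ.* mkℚᵘ z 0} {mkℚᵘ z k} (*≡* (≡.cong₂ ℤ._*_ (ℤₚ.*-identityˡ z) (≡.cong +_ (≡.sym (ℕₚ.*-identityʳ (suc k))))))))

1/k² : ∀ k → frac (+ 1) (suc k ℕ.^ 2) ≡ frac (+ 1) (suc k) ℚ.* frac (+ 1) (suc k)
1/k² k = ≡.trans (ℚₚ.fromℚᵘ-cong {mkℚᵘ (+ 1) _} {mkℚᵘ (+ 1) k ℚᵘ.* mkℚᵘ (+ 1) k}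
    (*≡* (≡.trans (ℤₚ.*-identityˡ _) (≡.trans (≡.cong (λ i → + (suc k ℕ.* i)) (≡.sym (ℕₚ.*-identityʳ (suc k)))) (≡.sym (ℤₚ.*-identityˡ _))))))
  (≡.sym (fromℚᵘ-* (mkℚᵘ (+ 1) k) (mkℚᵘ (+ 1) k)))

module ℚS = ℚSolver.+-*-Solver

negⁱ : ℚi → ℚi
negⁱ (a + b i) = (ℚ.- a) + (ℚ.- b) i

ℚi-commutativeRing : CommutativeRing 0ℓ 0ℓ
ℚi-commutativeRing = record
  { Carrier = ℚi ; _≈_ = _≡_ ; _+_ = _⊕_ ; _*_ = _⊛_ ; -_ = negⁱ ; 0# = ⟦ 0ℚ ⟧ ; 1# = ⟦ 1ℚ ⟧
  ; isCommutativeRing = record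
    { isRing = record
      { +-isAbelianGroup = record
        { isGroup = record
          { isMonoid = record
            { isSemigroup = record
              { isMagma = record { isEquivalence = ≡.isEquivalence ; ∙-cong = ≡.cong₂ _⊕_ }
              ; assoc = λ (a + b i) (c + d i) (e + f i) → ≡.cong₂ _+_i (ℚₚ.+-assoc a c e) (ℚₚ.+-assoc b d f) }
            ; identity = (λ (a + b i) → ≡.cong₂ _+_i (ℚₚ.+-identityˡ a) (ℚₚ.+-identityˡ b))
                       , (λ (a + b i) → ≡.cong₂ _+_i (ℚₚ.+-identityʳ a) (ℚₚ.+-identityʳ b)) }
          ; inverse = (λ (a + b i) → ≡.cong₂ _+_i (ℚₚ.+-inverseˡ a) (ℚₚ.+-inverseˡ b))
                    , (λ (a + b i) → ≡.cong₂ _+_i (ℚₚ.+-inverseʳ a) (ℚₚ.+-inverseʳ b))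
          ; ⁻¹-cong = ≡.cong negⁱ }
        ; comm = λ (a + b i) (c + d i) → ≡.cong₂ _+_i (ℚₚ.+-comm a c) (ℚₚ.+-comm b d) }
      ; *-cong = ≡.cong₂ _⊛_
      ; *-assoc = λ (a + b i) (c + d i) (e + f i) → ≡.cong₂ _+_i
          (solve 6 (λ a b c d e f → (a :* c :- b :* d) :* e :- (a :* d :+ b :* c) :* f := a :* (c :* e :- d :* f) :- b :* (c :* f :+ d :* e)) ≡.refl a b c d e f)
          (solve 6 (λ a b c d e f → (a :* c :- b :* d) :* f :+ (a :* d :+ b :* c) :* e := a :* (c :* f :+ d :* e) :+ b :* (c :* e :- d :* f)) ≡.refl a b c d e f)
      ; *-identity = (λ (a + b i) → ≡.cong₂ _+_i (solve 2 (λ a b → con 1ℚ :* a :- con 0ℚ :* b := a) ≡.refl a b) (solve 2 (λ a b → con 1ℚ :* b :+ con 0ℚ :* a := b) ≡.refl a b))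
                   , (λ (a + b i) → ≡.cong₂ _+_i (solve 2 (λ a b → a :* con 1ℚ :- b :* con 0ℚ := a) ≡.refl a b) (solve 2 (λ a b → a :* con 0ℚ :+ b :* con 1ℚ := b) ≡.refl a b))
      ; distrib = (λ (a + b i) (c + d i) (e + f i) → ≡.cong₂ _+_i
            (solve 6 (λ a b c d e f → a :* (c :+ e) :- b :* (d :+ f) := (a :* c :- b :* d) :+ (a :* e :- b :* f)) ≡.refl a b c d e f)
            (solve 6 (λ a b c d e f → a :* (d :+ f) :+ b :* (c :+ e) := (a :* d :+ b :* c) :+ (a :* f :+ b :* e)) ≡.refl a b c d e f))
                , (λ (a + b i) (c + d i) (e + f i) → ≡.cong₂ _+_i
            (solve 6 (λ a b c d e f → (c :+ e) :* a :- (d :+ f) :* b := (c :* a :- d :* b) :+ (e :* a :- f :* b)) ≡.refl a b c d e f)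
            (solve 6 (λ a b c d e f → (c :+ e) :* b :+ (d :+ f) :* a := (c :* b :+ d :* a) :+ (e :* b :+ f :* a)) ≡.refl a b c d e f))
      }
    ; *-comm = λ (a + b i) (c + d i) → ≡.cong₂ _+_i
        (solve 4 (λ a b c d → a :* c :- b :* d := c :* a :- d :* b) ≡.refl a b c d)
        (solve 4 (λ a b c d → a :* d :+ b :* c := c :* b :+ d :* a) ≡.refl a b c d) } }
  where open ℚS hiding (⟦_⟧)

⟦⟧-* : ∀ x y → ⟦ x ℚ.* y ⟧ ≡ ⟦ x ⟧ ⊛ ⟦ y ⟧
⟦⟧-* x y = ≡.cong₂ _+_i (solve 2 (λ x y → x :* y := x :* y :- con 0ℚ :* con 0ℚ) ≡.refl x y) (solve 2 (λ x y → con 0ℚ := x :* con 0ℚ :+ con 0ℚ :* y) ≡.refl x y)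
  where open ℚS hiding (⟦_⟧)

ℤ→ℚi : IntegersTo ℚi-commutativeRing
ℤ→ℚi = record
  { φ       = λ m → ⟦ m ℚ./ 1 ⟧
  ; +-homo  = λ m n → ≡.cong ⟦_⟧ (≡.sym (≡.trans (fromℚᵘ-+ (mkℚᵘ m 0) (mkℚᵘ n 0)) (≡.cong (λ i → i ℚ./ 1) (≡.cong₂ ℤ._+_ (ℤₚ.*-identityʳ m) (ℤₚ.*-identityʳ n)))))
  ; *-homo  = λ m n → ≡.trans (≡.cong ⟦_⟧ (≡.sym (fromℚᵘ-* (mkℚᵘ m 0) (mkℚᵘ n 0)))) (⟦⟧-* (m ℚ./ 1) (n ℚ./ 1))
  ; -‿homo  = λ m → ≡.cong ⟦_⟧ (≡.sym (fromℚᵘ-neg (mkℚᵘ m 0)))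
  ; 0-homo  = ≡.refl
  ; 1-homo  = ≡.refl
  }

module Exact = RingSums ℚi-commutativeRing ℤ→ℚi

-- The summand inside `polylog` is a local function; as a variable `t` it need only agree pointwise
-- with a named one.
foldr-applyUpTo : ∀ (t t′ : ℕ → ℚi) → (∀ k → t k ≡ t′ k) → ∀ g n →
  foldr _⊕_ ⟦ 0ℚ ⟧ (map t (applyUpTo g n)) ≡ Exact.Σ< n (t′ ∘ g)
foldr-applyUpTo t t′ eq g zero    = ≡.refl
foldr-applyUpTo t t′ eq g (suc n) = ≡.trans (≡.cong₂ _⊕_ (eq (g 0)) (foldr-applyUpTo t t′ eq (g ∘ suc) n)) (≡.sym (Exact.Σ-head n (t′ ∘ g)))

dilogTerm : ℚi → ℕ → ℚi
dilogTerm x zero    = ⟦ 0ℚ ⟧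
dilogTerm x (suc k) = ⟦ frac (+ 1) (suc k ℕ.^ 2) ⟧ ⊛ (x ^ⁱ suc k)

polylog≡Σ : ∀ p x → polylog p 2 x ≡ Exact.Σ< p (dilogTerm x)
polylog≡Σ p x = foldr-applyUpTo _ (dilogTerm x) (λ { zero → ≡.refl ; (suc k) → ≡.refl }) id p

open import Data.Nat using (_>_)
-- Here `d` is a reduced denominator, `g` the factor cancelled, and e f the denominator before
-- reduction.
∣-from-product : ∀ {d e f} g → + d ℤ.* g ≡ + e ℤ.* + f → d ∣ e ℕ.* f
∣-from-product {d} {e} {f} g eq = divides ℤ.∣ g ∣
  (≡.trans (≡.sym (ℤₚ.abs-* (+ e) (+ f))) (≡.trans (≡.cong ℤ.∣_∣ (≡.sym eq)) (≡.trans (ℤₚ.abs-* (+ d) g) (ℕₚ.*-comm d ℤ.∣ g ∣))))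

∣-from-product₁ : ∀ {d e} g → + d ℤ.* g ≡ + e → d ∣ e
∣-from-product₁ {d} {e} g eq = ≡.subst (d ∣_) (ℕₚ.*-identityʳ e) (∣-from-product {e = e} {f = 1} g (≡.trans eq (≡.sym (ℤₚ.*-identityʳ (+ e)))))

-- p-integrality and the residue ring

module Residues (n : ℕ) (p-prime : Prime (suc n)) where

  private
    p : ℕ
    p = suc n

  private module ℚⁱ = CommutativeRing ℚi-commutativeRing

  p∤1 : ¬ p ∣ 1
  p∤1 p∣1 with prime⇒nonTrivial p-prime
  ... | nt = ℕₚ.<⇒≱ (ℕ.nonTrivial⇒n>1 p {{nt}}) (∣⇒≤ p∣1)

  integral-+ : ∀ x y → pIntegralℚ p x → pIntegralℚ p y → pIntegralℚ p (x ℚ.+ y)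
  integral-+ x y ix iy p∣ = [ ix , iy ]′ (euclidsLemma (↧ₙ x) (↧ₙ y) p-prime (∣-trans p∣ (∣-from-product {e = ↧ₙ x} {f = ↧ₙ y} _ (ℚₚ.↧-+ x y))))

  integral-* : ∀ x y → pIntegralℚ p x → pIntegralℚ p y → pIntegralℚ p (x ℚ.* y)
  integral-* x y ix iy p∣ = [ ix , iy ]′ (euclidsLemma (↧ₙ x) (↧ₙ y) p-prime (∣-trans p∣ (∣-from-product {e = ↧ₙ x} {f = ↧ₙ y} _ (ℚₚ.↧-* x y))))

  integral-neg : ∀ x → pIntegralℚ p x → pIntegralℚ p (ℚ.- x)
  integral-neg x ix p∣ = ix (≡.subst (p ∣_) (ℤₚ.+-injective (ℚₚ.↧-neg x)) p∣)

  integral-/ : ∀ z d → ¬ p ∣ suc d → pIntegralℚ p (z ℚ./ suc d)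
  integral-/ z d p∤d p∣ = p∤d (∣-trans p∣ (∣-from-product₁ _ (ℚₚ.↧-/ z (suc d))))

  integralⁱ-⊕ : ∀ x y → pIntegral p x → pIntegral p y → pIntegral p (x ⊕ y)
  integralⁱ-⊕ (a + b i) (c + d i) (ia , ib) (ic , id) = integral-+ a c ia ic , integral-+ b d ib id

  integralⁱ-neg : ∀ x → pIntegral p x → pIntegral p (negⁱ x)
  integralⁱ-neg (a + b i) (ia , ib) = integral-neg a ia , integral-neg b ib

  integralⁱ-⊛ : ∀ x y → pIntegral p x → pIntegral p y → pIntegral p (x ⊛ y)
  integralⁱ-⊛ (a + b i) (c + d i) (ia , ib) (ic , id) =
    integral-+ (a ℚ.* c) (ℚ.- (b ℚ.* d)) (integral-* a c ia ic) (integral-neg (b ℚ.* d) (integral-* b d ib id)) ,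
    integral-+ (a ℚ.* d) (b ℚ.* c) (integral-* a d ia id) (integral-* b c ib ic)

  -- The p-integral Gaussian rationals, taken modulo p by _≋_.
  record K : Set where
    no-eta-equality
    constructor mkK
    field
      val      : ℚi
      integral : pIntegral p val
  open K public

  infix 4 _≋_
  -- A record, so that `u` and `v` can be recovered from the type of a proof and the congruence is
  -- not unfolded.
  record _≋_ (u v : K) : Set where
    constructor mk≋
    field
      congruent : val u ≡ val v [mod p ]
  open _≋_ public

  emb : ∀ x → pIntegralℚ p x → K
  emb x ix = mkK ⟦ x ⟧ (ix , p∤1)

  1/p : ℚi
  1/p = ⟦ frac (+ 1) p ⟧

  open Exact using (solve; con; _:=_; _:+_; _:*_; _:-_; :-_; :1)

  -- The quotient whose integrality is the congruence of u and v.
  δ : K → K → ℚi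
  δ u v = 1/p ⊛ (val u ⊖ val v)

  via : ∀ {u v} x → δ u v ≡ x → pIntegral p x → u ≋ v
  via x eq ix = mk≋ (≡.subst (pIntegral p) (≡.sym eq) ix)

  exact : ∀ {u v} → val u ≡ val v → u ≋ v
  exact {u} {v} eq = via {u} {v} ⟦ 0ℚ ⟧ (≡.trans (≡.cong (λ w → 1/p ⊛ (w ⊖ val v)) eq)
    (solve 2 (λ π x → π :* (x :- x) := con (+ 0)) ≡.refl 1/p (val v))) (p∤1 , p∤1)

  K-commutativeRing : CommutativeRing 0ℓ 0ℓ
  K-commutativeRing = record
    { Carrier = K ; _≈_ = _≋_
    ; _+_ = λ u v → mkK (val u ⊕ val v) (integralⁱ-⊕ (val u) (val v) (integral u) (integral v))
    ; _*_ = λ u v → mkK (val u ⊛ val v) (integralⁱ-⊛ (val u) (val v) (integral u) (integral v))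
    ; -_ = λ u → mkK (negⁱ (val u)) (integralⁱ-neg (val u) (integral u))
    ; 0# = mkK ⟦ 0ℚ ⟧ (p∤1 , p∤1) ; 1# = mkK ⟦ 1ℚ ⟧ (p∤1 , p∤1)
    ; isCommutativeRing = record
      { isRing = record
        { +-isAbelianGroup = record
          { isGroup = record
            { isMonoid = record
              { isSemigroup = record
                { isMagma = record
                  { isEquivalence = record
                    { refl  = exact ≡.refl
                    ; sym   = λ {u} {v} e → via {v} {u} (negⁱ (δ u v))
                        (solve 3 (λ π x y → π :* (y :- x) := :- (π :* (x :- y))) ≡.refl 1/p (val u) (val v))
                        (integralⁱ-neg (δ u v) (congruent e))
                    ; trans = λ {u} {v} {w} e f → via {u} {w} (δ u v ⊕ δ v w)
                        (solve 4 (λ π x y z → π :* (x :- z) := π :* (x :- y) :+ π :* (y :- z)) ≡.refl 1/p (val u) (val v) (val w))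
                        (integralⁱ-⊕ (δ u v) (δ v w) (congruent e) (congruent f)) }
                  ; ∙-cong = λ {u} {u′} {v} {v′} e f → via (δ u u′ ⊕ δ v v′)
                      (solve 5 (λ π x x′ y y′ → π :* ((x :+ y) :- (x′ :+ y′)) := π :* (x :- x′) :+ π :* (y :- y′)) ≡.refl 1/p (val u) (val u′) (val v) (val v′))
                      (integralⁱ-⊕ (δ u u′) (δ v v′) (congruent e) (congruent f)) }
                ; assoc = λ u v w → exact (ℚⁱ.+-assoc (val u) (val v) (val w)) }
              ; identity = (λ u → exact (ℚⁱ.+-identityˡ (val u))) , (λ u → exact (ℚⁱ.+-identityʳ (val u))) }
            ; inverse = (λ u → exact (ℚⁱ.-‿inverseˡ (val u))) , (λ u → exact (ℚⁱ.-‿inverseʳ (val u)))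
            ; ⁻¹-cong = λ {u} {u′} e → via (negⁱ (δ u u′))
                (solve 3 (λ π x x′ → π :* (:- x :- (:- x′)) := :- (π :* (x :- x′))) ≡.refl 1/p (val u) (val u′))
                (integralⁱ-neg (δ u u′) (congruent e)) }
          ; comm = λ u v → exact (ℚⁱ.+-comm (val u) (val v)) }
        ; *-cong = λ {u} {u′} {v} {v′} e f → via ((δ u u′ ⊛ val v) ⊕ (val u′ ⊛ δ v v′))
            (solve 5 (λ π x x′ y y′ → π :* (x :* y :- x′ :* y′) := (π :* (x :- x′)) :* y :+ x′ :* (π :* (y :- y′))) ≡.refl 1/p (val u) (val u′) (val v) (val v′))
            (integralⁱ-⊕ (δ u u′ ⊛ val v) (val u′ ⊛ δ v v′) (integralⁱ-⊛ (δ u u′) (val v) (congruent e) (integral v)) (integralⁱ-⊛ (val u′) (δ v v′) (integral u′) (congruent f)))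
        ; *-assoc = λ u v w → exact (ℚⁱ.*-assoc (val u) (val v) (val w))
        ; *-identity = (λ u → exact (ℚⁱ.*-identityˡ (val u))) , (λ u → exact (ℚⁱ.*-identityʳ (val u)))
        ; distrib = (λ u v w → exact (ℚⁱ.distribˡ (val u) (val v) (val w))) , (λ u v w → exact (ℚⁱ.distribʳ (val u) (val v) (val w))) }
      ; *-comm = λ u v → exact (ℚⁱ.*-comm (val u) (val v)) } }

  ℤ→K : IntegersTo K-commutativeRing
  ℤ→K = record
    { φ = λ z → emb (z ℚ./ 1) (integral-/ z 0 p∤1)
    ; +-homo = λ x y → exact (E.+-homo x y) ; *-homo = λ x y → exact (E.*-homo x y) ; -‿homo = λ x → exact (E.-‿homo x)
    ; 0-homo = exact ≡.refl ; 1-homo = exact ≡.refl }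
    where module E = IntegersTo ℤ→ℚi

  p≋0 : IntegersTo.φ ℤ→K (+ p) ≋ CommutativeRing.0# K-commutativeRing
  p≋0 = via ⟦ 1ℚ ⟧ (≡.trans (solve 2 (λ π x → π :* (x :- con (+ 0)) := x :* π) ≡.refl 1/p ⟦ + p ℚ./ 1 ⟧)
    (≡.trans (≡.sym (⟦⟧-* (+ p ℚ./ 1) (frac (+ 1) p))) (≡.cong ⟦_⟧ (k*1/k≡1 n)))) (p∤1 , p∤1)

  -- An element of `K` needs a proof of integrality at every index, so multiples of p get the
  -- default value 0; the inverses wanted are those below p.
  a : ℕ → K
  a zero    = emb 0ℚ p∤1
  a (suc k) with p ∣? suc k
  ... | yes _ = emb 0ℚ p∤1
  ... | no p∤ = emb (frac (+ 1) (suc k)) (integral-/ (+ 1) k p∤)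

  p∤k : ∀ k → 0 < k → k < p → ¬ p ∣ k
  p∤k (suc k) _ k<p p∣k = ℕₚ.<⇒≱ k<p (∣⇒≤ p∣k)

  val-a : ∀ k → k < p → val (a k) ≡ ⟦ frac (+ 1) k ⟧
  val-a zero    _ = ≡.refl
  val-a (suc k) k<p with p ∣? suc k
  ... | yes p∣ = contradiction p∣ (p∤k (suc k) (s≤s z≤n) k<p)
  ... | no _   = ≡.refl

  1/k : ℕ → ℚi
  1/k k = ⟦ frac (+ 1) k ⟧

  k*1/k : ∀ k → Exact.ι (suc k) ⊛ 1/k (suc k) ≡ ⟦ 1ℚ ⟧
  k*1/k k = ≡.trans (≡.sym (⟦⟧-* (+ suc k ℚ./ 1) (frac (+ 1) (suc k)))) (≡.cong ⟦_⟧ (k*1/k≡1 k))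

  a-inverse : ∀ k → 0 < k → k < p → CommutativeRing._≈_ K-commutativeRing (CommutativeRing._*_ K-commutativeRing (IntegersTo.φ ℤ→K (+ k)) (a k)) (CommutativeRing.1# K-commutativeRing)
  a-inverse (suc k) _ k<p = exact (≡.trans (≡.cong (Exact.ι (suc k) ⊛_) (val-a (suc k) k<p)) (k*1/k k))

  -- The reduced denominator of z / p divides p. It is not p, by integrality, so it is 1, and then p
  -- is the gcd of z and p.
  p∣-if-≋0 : ∀ z → IntegersTo.φ ℤ→K z ≋ CommutativeRing.0# K-commutativeRing → p ∣ ℤ.∣ z ∣
  p∣-if-≋0 z (mk≋ c) = divisible (prime⇒irreducible p-prime (∣-from-product₁ _ (ℚₚ.↧-/ z p)))
    where
    eq : 1/p ⊛ (⟦ z ℚ./ 1 ⟧ ⊖ ⟦ 0ℚ ⟧) ≡ ⟦ z ℚ./ p ⟧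
    eq = ≡.trans (solve 2 (λ π x → π :* (x :- con (+ 0)) := π :* x) ≡.refl 1/p ⟦ z ℚ./ 1 ⟧)
           (≡.trans (≡.sym (⟦⟧-* (frac (+ 1) p) (z ℚ./ 1))) (≡.cong ⟦_⟧ (≡.sym (frac-* z n))))
    divisible : ↧ₙ (z ℚ./ p) ≡ 1 ⊎ ↧ₙ (z ℚ./ p) ≡ p → p ∣ ℤ.∣ z ∣
    divisible (inj₂ ↧≡p) = contradiction (≡.subst (p ∣_) (≡.sym ↧≡p) ∣-refl) (proj₁ (≡.subst (pIntegral p) eq c))
    divisible (inj₁ ↧≡1) = ≡.subst (_∣ ℤ.∣ z ∣) gcd≡p (gcd[m,n]∣m ℤ.∣ z ∣ p)
      where
      gcd≡p : gcd ℤ.∣ z ∣ p ≡ p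
      gcd≡p = ℤₚ.+-injective (≡.trans (≡.sym (ℤₚ.*-identityˡ _)) (≡.trans (≡.cong (λ d → + d ℤ.* + gcd ℤ.∣ z ∣ p) (≡.sym ↧≡1)) (ℚₚ.↧-/ z p)))

-- Exact values in ℚ(i) and transfer to the congruences

module Evaluation (n : ℕ) (p-prime : Prime (suc n)) (3≤n : 3 ≤ n) (m : ℕ) (n≡m+m : n ≡ m ℕ.+ m) where

  open Residues n p-prime

  open CharacteristicP K-commutativeRing ℤ→K n a p≋0 (exact ≡.refl) a-inverse 3≤n
    hiding (solve; con; _:=_; _:+_; _:*_; _:-_; :-_; :1; Polynomial)

  val-Σ : ∀ k f → val (Σ< k f) ≡ Exact.Σ< k (val ∘ f)
  val-Σ zero    f = ≡.refl
  val-Σ (suc k) f = ≡.cong (_⊕ val (f k)) (val-Σ k f)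

  val-^ : ∀ x k → val (x ^ k) ≡ val x Exact.^ k
  val-^ x zero    = ≡.refl
  val-^ x (suc k) = ≡.cong (val x ⊛_) (val-^ x k)

  ^ⁱ≡^ : ∀ x k → x ^ⁱ k ≡ x Exact.^ k
  ^ⁱ≡^ x zero    = ≡.refl
  ^ⁱ≡^ x (suc k) = ≡.cong (x ⊛_) (^ⁱ≡^ x k)

  polylog≡Li₂ : ∀ x → polylog p 2 (val x) ≡ val (Li₂ x)
  polylog≡Li₂ x = ≡.trans (polylog≡Σ p (val x)) (≡.trans (Exact.Σ-cong p λ
    { zero    _   → Exact.solve 1 (λ y → Exact.con (+ 0) Exact.:= (Exact.con (+ 0) Exact.:* Exact.con (+ 0)) Exact.:* y) ≡.refl ⟦ 1ℚ ⟧
    ; (suc k) k<p → ≡.cong₂ _⊛_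
        (≡.trans (≡.cong ⟦_⟧ (1/k² k)) (≡.trans (⟦⟧-* (frac (+ 1) (suc k)) (frac (+ 1) (suc k))) (≡.sym (≡.cong₂ _⊛_ (val-a (suc k) k<p) (val-a (suc k) k<p)))))
        (≡.trans (^ⁱ≡^ (val x) (suc k)) (≡.sym (val-^ x (suc k)))) })
    (≡.sym (val-Σ p (λ k → (a k * a k) * x ^ k))))

  -- r (1 + ℓ I) is (1 + I)^p, and s = (r - 1)/p.
  r : ℤ
  r = η m ℤ.* + (2 ℕ.^ m)

  r*r≡2^n : r ℤ.* r ≡ + (2 ℕ.^ n)
  r*r≡2^n = ≡.trans (ℤΣ.solve 2 (λ e t → (e ℤΣ.:* t) ℤΣ.:* (e ℤΣ.:* t) ℤΣ.:= (e ℤΣ.:* e) ℤΣ.:* (t ℤΣ.:* t)) ≡.refl (η m) (+ (2 ℕ.^ m)))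
    (≡.trans (≡.cong₂ ℤ._*_ (η*η≡1 m) (≡.sym (ℤₚ.pos-* (2 ℕ.^ m) (2 ℕ.^ m))))
    (≡.trans (ℤₚ.*-identityˡ _) (≡.cong +_ (≡.trans (≡.sym (ℕₚ.^-distribˡ-+-* 2 m m)) (≡.cong (2 ℕ.^_) (≡.sym n≡m+m))))))

  s q : ℚ
  s = frac (+ 1) p ℚ.* ((r ℚ./ 1) ℚ.- 1ℚ)
  q = fermatQuotient p 2

  -- With r = 1 + p s and r² = 2^(p-1), this is ((1 + p s)² - 1) / p. The quadratic term vanishes
  -- modulo p once s is known to be integral.
  q≡ : q ≡ (s ℚ.+ s) ℚ.+ (+ p ℚ./ 1) ℚ.* (s ℚ.* s)
  q≡ = ≡.trans (frac-* (+ (2 ℕ.^ n) ℤ.- + 1) n) (≡.trans (≡.cong (frac (+ 1) p ℚ.*_)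
      (≡.trans (≡.cong re (Exact.+-homo (+ (2 ℕ.^ n)) (ℤ.- + 1))) (≡.cong (ℚ._- 1ℚ)
        (≡.trans (≡.cong (ℚ._/ 1) (≡.sym r*r≡2^n)) (≡.sym (fromℚᵘ-* (mkℚᵘ r 0) (mkℚᵘ r 0)))))))
    (quadratic (frac (+ 1) p) (r ℚ./ 1) (+ p ℚ./ 1) (k*1/k≡1 n)))
    where
    quadratic : ∀ π u P → P ℚ.* π ≡ 1ℚ →
      π ℚ.* (u ℚ.* u ℚ.- 1ℚ) ≡ (π ℚ.* (u ℚ.- 1ℚ) ℚ.+ π ℚ.* (u ℚ.- 1ℚ)) ℚ.+ P ℚ.* ((π ℚ.* (u ℚ.- 1ℚ)) ℚ.* (π ℚ.* (u ℚ.- 1ℚ)))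
    quadratic π u P Pπ≡1 = ≡.trans
      (ℚS.solve 2 (λ π u → π :* (u :* u :- con 1ℚ) := (π :* (u :- con 1ℚ) :+ π :* (u :- con 1ℚ)) :+ con 1ℚ :* (π :* (u :- con 1ℚ) :* (u :- con 1ℚ))) ≡.refl π u)
      (≡.trans (≡.cong (λ o → (π ℚ.* (u ℚ.- 1ℚ) ℚ.+ π ℚ.* (u ℚ.- 1ℚ)) ℚ.+ o ℚ.* (π ℚ.* (u ℚ.- 1ℚ) ℚ.* (u ℚ.- 1ℚ))) (≡.sym Pπ≡1))
      (ℚS.solve 3 (λ π u P → (π :* (u :- con 1ℚ) :+ π :* (u :- con 1ℚ)) :+ (P :* π) :* (π :* (u :- con 1ℚ) :* (u :- con 1ℚ))
          := (π :* (u :- con 1ℚ) :+ π :* (u :- con 1ℚ)) :+ P :* ((π :* (u :- con 1ℚ)) :* (π :* (u :- con 1ℚ)))) ≡.refl π u P))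
      where open ℚS using (con; _:=_; _:+_; _:*_; _:-_)

  module AtUnit (ε : ℚ) (ε-integral : pIntegralℚ p ε) (ε*ε≡1 : ε ℚ.* ε ≡ 1ℚ) where

    I : K
    I = mkK (0ℚ + ε i) (p∤1 , ε-integral)

    I²≡-1 : val I ⊛ val I ≡ Exact.-1#
    I²≡-1 = ≡.cong₂ _+_i
      (≡.trans (ℚS.solve 1 (λ e → con 0ℚ :* con 0ℚ :- e :* e := :- (e :* e)) ≡.refl ε) (≡.cong ℚ.-_ ε*ε≡1))
      (ℚS.solve 1 (λ e → con 0ℚ :* e :+ e :* con 0ℚ := con 0ℚ) ≡.refl ε)
      where open ℚS using (con; _:=_; _:+_; _:*_; _:-_; :-_)

    ℓⁱ : ℚi
    ℓⁱ = Exact.-1# Exact.^ m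

    V : ℚi
    V = Exact.Σ< n (λ k → Exact.ι (n C k) ⊛ (1/k (suc k) ⊛ (val I Exact.^ suc k)))

    -- By the exact powers of I and I + 1, p V = r (1 + ℓ I) - 1 - ℓ I = (r - 1)(1 + ℓ I), and in
    -- ℚ(i) this can be divided by p.
    V≡s[1+ℓI] : V ≡ ⟦ s ⟧ ⊛ (⟦ 1ℚ ⟧ ⊕ ℓⁱ ⊛ val I)
    V≡s[1+ℓI] = ≡.trans (cancel-p V _ (Exact.p*binomialSum n 1/k (val I) k*1/k))
      (≡.trans (≡.cong₂ (λ x y → 1/p ⊛ ((x ⊖ ⟦ 1ℚ ⟧) ⊖ y))
          (≡.trans (≡.cong (λ k → (val I ⊕ ⟦ 1ℚ ⟧) Exact.^ suc k) n≡m+m) ([I+1]^[1+m+m] m))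
          (≡.trans (≡.cong (λ k → val I Exact.^ suc k) n≡m+m) (I^[1+m+m] m)))
      (≡.trans (factor 1/p (Exact.φ r) (ℓⁱ ⊛ val I))
        (≡.cong (_⊛ (⟦ 1ℚ ⟧ ⊕ ℓⁱ ⊛ val I)) (≡.sym (⟦⟧-* (frac (+ 1) p) ((r ℚ./ 1) ℚ.- 1ℚ))))))
      where
      open Exact.SquareRootOf-1 (val I) I²≡-1
      factor : ∀ π x j → π ⊛ ((x ⊛ (⟦ 1ℚ ⟧ ⊕ j) ⊖ ⟦ 1ℚ ⟧) ⊖ j) ≡ (π ⊛ (x ⊖ ⟦ 1ℚ ⟧)) ⊛ (⟦ 1ℚ ⟧ ⊕ j)
      factor π x j = Exact.solve 3 (λ π x j → π E.:* ((x E.:* (E.:1 E.:+ j) E.:- E.:1) E.:- j) E.:= (π E.:* (x E.:- E.:1)) E.:* (E.:1 E.:+ j)) ≡.refl π x j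
        where module E = Exact
      cancel-p : ∀ v w → Exact.ι p ⊛ v ≡ w → v ≡ 1/p ⊛ w
      cancel-p v w eq = ≡.trans (≡.sym (Exact.*-identityˡ v)) (≡.trans (≡.cong (_⊛ v) (≡.trans (≡.sym (k*1/k n)) (Exact.*-comm (Exact.ι p) 1/p)))
        (≡.trans (Exact.*-assoc 1/p (Exact.ι p) v) (≡.cong (1/p ⊛_) eq)))

    Vₖ : K
    Vₖ = Σ< n (λ k → ι (n C k) * (a (suc k) * I ^ suc k))

    val-Vₖ : val Vₖ ≡ V
    val-Vₖ = ≡.trans (val-Σ n _) (Exact.Σ-cong n λ k k<n →
      ≡.cong (Exact.ι (n C k) ⊛_) (≡.cong₂ _⊛_ (val-a (suc k) (s≤s k<n)) (val-^ I (suc k))))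

    -- The sum `V` has p-integral terms and real part s. The statement amounts to 2^m ≡ η m modulo
    -- p, the classical value of (2/p), which thus needs no proof of its own.
    s-integral : pIntegralℚ p s
    s-integral = ≡.subst (pIntegralℚ p) re≡s (proj₁ (integral Vₖ))
      where
      re≡s : re (val Vₖ) ≡ s
      re≡s = ≡.trans (≡.cong re (≡.trans val-Vₖ V≡s[1+ℓI]))
        -- The power of -1 is replaced by the image of an integer, so that it is visibly real when
        -- the real part is taken.
        (≡.trans (≡.cong (λ l → re (⟦ s ⟧ ⊛ (⟦ 1ℚ ⟧ ⊕ l ⊛ val I))) (≡.sym (Exact.φ-±1 m)))
          (ℚS.solve 3 (λ s l e → s :* (con 1ℚ :+ (l :* con 0ℚ :- con 0ℚ :* e)) :- con 0ℚ :* (con 0ℚ :+ (l :* e :+ con 0ℚ :* con 0ℚ)) := s) ≡.refl s (±1 m ℚ./ 1) ε))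
        where open ℚS using (con; _:=_; _:+_; _:*_; _:-_)

    sₖ : K
    sₖ = emb s s-integral

    Li₁[-I] : Li₁ (- I) ≈ - (sₖ * (1# + -1# ^ m * I))
    Li₁[-I] = Li₁[-x] {I} {sₖ * (1# + -1# ^ m * I)} (exact (≡.trans val-Vₖ (≡.trans V≡s[1+ℓI] (≡.cong (λ l → ⟦ s ⟧ ⊛ (⟦ 1ℚ ⟧ ⊕ l ⊛ val I)) (≡.sym (val-^ -1# m))))))

    q-integral : pIntegralℚ p q
    q-integral = ≡.subst (pIntegralℚ p) (≡.sym q≡) (integral-+ (s ℚ.+ s) ((+ p ℚ./ 1) ℚ.* (s ℚ.* s)) (integral-+ s s s-integral s-integral)
      (integral-* (+ p ℚ./ 1) (s ℚ.* s) (integral-/ (+ p) 0 p∤1) (integral-* s s s-integral s-integral)))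

    qₖ : K
    qₖ = emb q q-integral

    q≈s+s : qₖ ≈ sₖ + sₖ
    q≈s+s = trans (exact {qₖ} {(sₖ + sₖ) + ι p * (sₖ * sₖ)} (≡.trans (≡.cong ⟦_⟧ q≡)
        (≡.cong (⟦ s ℚ.+ s ⟧ ⊕_) (≡.trans (⟦⟧-* (+ p ℚ./ 1) (s ℚ.* s)) (≡.cong (⟦ + p ℚ./ 1 ⟧ ⊛_) (⟦⟧-* s s))))))
      (trans (+-congˡ {sₖ + sₖ} (trans (*-congʳ {sₖ * sₖ} p≋0) (zeroˡ (sₖ * sₖ)))) (+-identityʳ (sₖ + sₖ)))

    open EulerNumbersIn K-commutativeRing ℤ→K
    open Values m n≡m+m E 1-homo E-odd E-even I (exact I²≡-1)

    a₂≡½ : val (a 2) ≡ ⟦ + 1 ℚ./ 2 ⟧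
    a₂≡½ = val-a 2 2<p

    ½-integral : pIntegralℚ p (+ 1 ℚ./ 2)
    ½-integral = ≡.subst (pIntegralℚ p) (≡.cong re a₂≡½) (proj₁ (integral (a 2)))

    ¼ ⅛ ℓℚ eℚ : ℚ
    ¼ = + 1 ℚ./ 4
    ⅛ = + 1 ℚ./ 8
    ℓℚ = legendre -[1+ 0 ] p ℚ./ 1
    eℚ = eulerNumber (p ∸ 3) ℚ./ 1

    ¼-integral : pIntegralℚ p ¼
    ¼-integral = integral-* (+ 1 ℚ./ 2) (+ 1 ℚ./ 2) ½-integral ½-integral

    ⅛-integral : pIntegralℚ p ⅛
    ⅛-integral = integral-* ¼ (+ 1 ℚ./ 2) ¼-integral ½-integral

    neg⅛q² : K
    neg⅛q² = emb (ℚ.- (q ℚ.* q ℚ.* ⅛)) (integral-neg (q ℚ.* q ℚ.* ⅛) (integral-* (q ℚ.* q) ⅛ (integral-* q q q-integral q-integral) ⅛-integral))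

    neg⅛q²≈ : neg⅛q² ≈ - (qₖ * qₖ * (a 2 * a 2 * a 2))
    neg⅛q²≈ = exact (≡.cong negⁱ (≡.trans (⟦⟧-* (q ℚ.* q) ⅛) (≡.cong₂ _⊛_ (⟦⟧-* q q)
      (≡.sym (≡.cong (λ h → h ⊛ h ⊛ h) a₂≡½)))))

    ℓₖ eₖ : K
    ℓₖ = φ (legendre -[1+ 0 ] p)
    eₖ = φ (eulerNumber (p ∸ 3))

    open Legendre m n≡m+m p∤1 p∣-if-≋0 using (φ-legendre)

    εi : ∀ δ → pIntegralℚ p δ → K
    εi δ iδ = emb δ iδ * mkK 𝕚 (p∤1 , p∤1)

    val-εi : ∀ δ → ⟦ δ ⟧ ⊛ 𝕚 ≡ 0ℚ + δ i
    val-εi δ = ≡.cong₂ _+_i (ℚS.solve 1 (λ d → d :* con 0ℚ :- con 0ℚ :* con 1ℚ := con 0ℚ) ≡.refl δ)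
                            (ℚS.solve 1 (λ d → d :* con 1ℚ :+ con 0ℚ :* con 0ℚ := d) ≡.refl δ)
      where open ℚS using (con; _:=_; _:+_; _:*_; _:-_)

    -- The values are exchanged while `x` and `y` are still variables, so the congruence is
    -- transported without normalising the expressions in it.
    ≋⇒mod : ∀ u v x y → val u ≡ x → val v ≡ y → u ≋ v → x ≡ y [mod p ]
    ≋⇒mod u v x y ≡.refl ≡.refl u≋v = congruent u≋v

    -- The second pair carries the opposite sign, because the reciprocal of 1 + ε i is (1 - ε i)/2.
    lhs₁ lhs₂ rhs₁ rhs₂ : ℚi
    lhs₁ = 1ℚ + ε i
    lhs₂ = (+ 1 ℚ./ 2) + ((ℚ.- ε) ℚ.* (+ 1 ℚ./ 2)) i
    rhs₁ = ⟦ ℚ.- (q ℚ.* q ℚ.* ⅛) ⟧ ⊛ (⟦ 1ℚ ⟧ ⊕ ⟦ ε ⟧ ⊛ 𝕚 ⊛ ⟦ ℓℚ ⟧) ⊕ ⟦ (+ 1 ℚ./ 2) ℚ.* ℓℚ ℚ.* eℚ ⟧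
    rhs₂ = ⟦ ℚ.- (q ℚ.* q ℚ.* ⅛) ⟧ ⊕ ⟦ ¼ ⟧ ⊛ (⟦ ℓℚ ⟧ ⊕ ⟦ ℚ.- ε ⟧ ⊛ 𝕚) ⊛ ⟦ eℚ ⟧

    ½ℓe ¼ₖ R₁ R₂ : K
    ½ℓe = emb ((+ 1 ℚ./ 2) ℚ.* ℓℚ ℚ.* eℚ) (integral-* ((+ 1 ℚ./ 2) ℚ.* ℓℚ) eℚ
            (integral-* (+ 1 ℚ./ 2) ℓℚ ½-integral (integral-/ (legendre -[1+ 0 ] p) 0 p∤1)) (integral-/ (eulerNumber (p ∸ 3)) 0 p∤1))
    ¼ₖ  = emb ¼ ¼-integral
    R₁  = neg⅛q² * (1# + εi ε ε-integral * ℓₖ) + ½ℓe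
    R₂  = neg⅛q² + ¼ₖ * (ℓₖ + εi (ℚ.- ε) (integral-neg ε ε-integral)) * eₖ

    ½ℓe≈ : ½ℓe ≈ a 2 * ℓₖ * eₖ
    ½ℓe≈ = exact (≡.trans (⟦⟧-* ((+ 1 ℚ./ 2) ℚ.* ℓℚ) eℚ) (≡.cong (_⊛ ⟦ eℚ ⟧)
             (≡.trans (⟦⟧-* (+ 1 ℚ./ 2) ℓℚ) (≡.cong (_⊛ ⟦ ℓℚ ⟧) (≡.sym a₂≡½)))))

    ¼ₖ≈ : ¼ₖ ≈ a 2 * a 2
    ¼ₖ≈ = exact (≡.sym (≡.cong (λ h → h ⊛ h) a₂≡½))

    lhs₁≡ : val (Li₂ (1# + I)) ≡ polylog p 2 lhs₁
    lhs₁≡ = ≡.trans (≡.sym (polylog≡Li₂ (1# + I))) (≡.cong (λ y → polylog p 2 (1ℚ + y i)) (ℚₚ.+-identityˡ ε))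

    lhs₂≡ : val (Li₂ (a 2 + - I * a 2)) ≡ polylog p 2 lhs₂
    lhs₂≡ = ≡.trans (≡.sym (polylog≡Li₂ (a 2 + - I * a 2))) (≡.cong (polylog p 2)
        (≡.trans (≡.cong (λ h → h ⊕ negⁱ (val I) ⊛ h) a₂≡½) (≡.cong₂ _+_i
          (ℚS.solve 1 (λ d → con (+ 1 ℚ./ 2) :+ (con 0ℚ :* con (+ 1 ℚ./ 2) :- d :* con 0ℚ) := con (+ 1 ℚ./ 2)) ≡.refl (ℚ.- ε))
          (ℚS.solve 1 (λ d → con 0ℚ :+ (con 0ℚ :* con 0ℚ :+ d :* con (+ 1 ℚ./ 2)) := d :* con (+ 1 ℚ./ 2)) ≡.refl (ℚ.- ε)))))
      where open ℚS using (con; _:=_; _:+_; _:*_; _:-_)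

    Li₂≈R₁ : Li₂ (1# + I) ≈ R₁
    Li₂≈R₁ = formula₁ sₖ Li₁[-I] {qₖ} {neg⅛q²} {εi ε ε-integral} {ℓₖ} {½ℓe} q≈s+s neg⅛q²≈ (exact (val-εi ε)) φ-legendre ½ℓe≈

    Li₂≈R₂ : Li₂ (a 2 + - I * a 2) ≈ R₂
    Li₂≈R₂ = formula₂ sₖ Li₁[-I] {qₖ} {neg⅛q²} {εi (ℚ.- ε) (integral-neg ε ε-integral)} {ℓₖ} {¼ₖ} q≈s+s neg⅛q²≈ (exact (val-εi (ℚ.- ε))) φ-legendre ¼ₖ≈

    -- No abbreviations in these two types: unfolding the congruences to compare them
    -- with the theorem is not feasible, so they have to match it syntactically.
    polylog[1+εi] : polylog (suc n) 2 (1ℚ + ε i)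
      ≡ ⟦ ℚ.- (fermatQuotient (suc n) 2 ℚ.* fermatQuotient (suc n) 2 ℚ.* (+ 1 ℚ./ 8)) ⟧
      ⊛ (⟦ 1ℚ ⟧ ⊕ ⟦ ε ⟧ ⊛ 𝕚 ⊛ ⟦ (legendre -[1+ 0 ] (suc n) ℚ./ 1) ⟧)
      ⊕ ⟦ (+ 1 ℚ./ 2) ℚ.* (legendre -[1+ 0 ] (suc n) ℚ./ 1) ℚ.* (eulerNumber (suc n ∸ 3) ℚ./ 1) ⟧
      [mod suc n ]
    polylog[1+εi] = ≋⇒mod (Li₂ (1# + I)) R₁ (polylog p 2 lhs₁) rhs₁ lhs₁≡ ≡.refl Li₂≈R₁

    polylog[[1+δi]/2] : ∀ δ → δ ≡ ℚ.- ε → polylog (suc n) 2 ((+ 1 ℚ./ 2) + (δ ℚ.* (+ 1 ℚ./ 2)) i)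
      ≡ ⟦ ℚ.- (fermatQuotient (suc n) 2 ℚ.* fermatQuotient (suc n) 2 ℚ.* (+ 1 ℚ./ 8)) ⟧
      ⊕ ⟦ + 1 ℚ./ 4 ⟧ ⊛ (⟦ (legendre -[1+ 0 ] (suc n) ℚ./ 1) ⟧ ⊕ ⟦ δ ⟧ ⊛ 𝕚)
      ⊛ ⟦ (eulerNumber (suc n ∸ 3) ℚ./ 1) ⟧
      [mod suc n ]
    polylog[[1+δi]/2] _ ≡.refl = ≋⇒mod (Li₂ (a 2 + - I * a 2)) R₂ (polylog p 2 lhs₂) rhs₂ lhs₂≡ ≡.refl Li₂≈R₂

prime>3⇒odd : ∀ {n} → Prime (suc n) → 3 ≤ n → Σ ℕ λ m → n ≡ m ℕ.+ m
prime>3⇒odd {n} p-prime 3≤n with parity n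
... | m , inj₁ n≡ = m , n≡
... | m , inj₂ n≡ with prime⇒irreducible p-prime (divides {2} (suc m) (≡.trans (≡.cong suc n≡) (≡.trans (≡.cong suc (≡.sym (ℕₚ.+-suc m m))) (≡.trans (≡.cong (suc m ℕ.+_) (≡.sym (ℕₚ.+-identityʳ (suc m)))) (ℕₚ.*-comm 2 (suc m))))))
...   | inj₁ ()
...   | inj₂ ≡.refl = contradiction 3≤n λ { (s≤s ()) }

open import Data.Nat using (_>_)
open import Data.Rational using (_/_; _*_; -_)

theorem4p2 : (p : ℕ) → Prime p → p > 3 →
    (ε : ℚ) → (ε ≡ 1ℚ ⊎ ε ≡ - 1ℚ) →
    (polylog p 2 (1ℚ + ε i)
    ≡ ⟦ - (fermatQuotient p 2 * fermatQuotient p 2 * (+ 1 / 8)) ⟧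
    ⊛ (⟦ 1ℚ ⟧ ⊕ ⟦ ε ⟧ ⊛ 𝕚 ⊛ ⟦ (legendre -[1+ 0 ] p / 1) ⟧)
    ⊕ ⟦ (+ 1 / 2) * (legendre -[1+ 0 ] p / 1) * (eulerNumber (p ∸ 3) / 1) ⟧
    [mod p ])
    ×
    (polylog p 2 ((+ 1 / 2) + (ε * (+ 1 / 2)) i)
    ≡ ⟦ - (fermatQuotient p 2 * fermatQuotient p 2 * (+ 1 / 8)) ⟧
    ⊕ ⟦ + 1 / 4 ⟧ ⊛ (⟦ (legendre -[1+ 0 ] p / 1) ⟧ ⊕ ⟦ ε ⟧ ⊛ 𝕚)
    ⊛ ⟦ (eulerNumber (p ∸ 3) / 1) ⟧
    [mod p ])
-- Each instance of `AtUnit` yields the first congruence at its own sign and the second at the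
-- opposite sign, so both cases draw on both instances.
theorem4p2 (suc n) p-prime (s≤s 3≤n) ε ε≡±1 = [ (λ { ≡.refl → plus.polylog[1+εi] , minus.polylog[[1+δi]/2] 1ℚ ≡.refl })
                                              , (λ { ≡.refl → minus.polylog[1+εi] , plus.polylog[[1+δi]/2] (- 1ℚ) ≡.refl }) ]′ ε≡±1
  where
  open Residues n p-prime using (p∤1)
  odd = prime>3⇒odd p-prime 3≤n
  open Evaluation n p-prime 3≤n (proj₁ odd) (proj₂ odd)
  module plus = AtUnit 1ℚ p∤1 ≡.refl
  module minus = AtUnit (- 1ℚ) p∤1 ≡.refl
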